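{- Let $\mathcal{D}$ be a p-admissible concrete domain, $\mathcal{O}$ an $\mathcal{EL}_\bot[\mathcal{D}]$ ontology, and $\mathcal{O}'$ the final ontology computed by Algorithm 1 (given in the context) on $\mathcal{O}$. Let $C,D$ be $\mathcal{EL}_\bot[\mathcal{D}]$ concepts whose constraints occur in $\mathcal{O}$. Given an Elk-proof $\mathcal{P}'$ for $\mathcal{O}'\models C^{ -\mathcal{D}}\sqsubseteq D^{ -\mathcal{D}}$ and $\mathcal{D}$-proofs for all $\mathcal{D}$-implications $\alpha_1\wedge\dots\wedge\alpha_n\to\beta$ used in $\mathcal{P}'$, one can construct in polynomial time an $\mathcal{EL}_\bot[\mathcal{D}]$-proof for $\mathcal{O}\models C\sqsubseteq D$.
   Context: **Concrete domains.** A concrete domain $\mathcal{D}$ consists of a set $\Delta^{\mathcal{D}}$ and relations on it interpreting a set of predicates, including a nullary predicate $\bot$ (interpreted as $\emptyset$) and a unary predicate $\top$ (interpreted as $\Delta^{\mathcal{D}}$). A constraint is a predicate applied to variables. An implication $\gamma\to\delta$ ($\gamma$ a conjunction, $\delta$ a disjunction of constraints) is valid, $\mathcal{D}\models\gamma\to\delta$, if each assignment of elements of $\Delta^{\mathcal{D}}$ to the variables satisfying all of $\gamma$ satisfies some constraint in $\delta$. $\mathcal{D}$ is p-admissible if validity of implications is decidable in polynomial time and $\mathcal{D}$ is convex (each valid $\gamma\to\delta$ has a disjunct $\alpha$ of $\delta$ with $\gamma\to\alpha$ valid). **The logic.** $\mathcal{EL}_\bot$ concepts: $C,D::=\top\mid\bot\mid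 A\mid C\sqcap D\mid\exists r.C$ with concept names $A$ and role names $r$; $\mathcal{EL}_\bot[\mathcal{D}]$ additionally allows concepts $[\alpha]$ for constraints $\alpha$, and $[\bot]$ is identified with $\bot$. Variables are interpreted as partial functions $x^{\mathcal{I}}:\Delta^{\mathcal{I}}\to\Delta^{\mathcal{D}}$, and $[\alpha]^{\mathcal{I}}$ is the set of $d$ for which $x^{\mathcal{I}}(d)$ is defined for all variables $x$ of $\alpha$ and these values satisfy $\alpha$. An ontology is a finite set of axioms $C\sqsubseteq D$; entailment is defined as usual. $\mathsf{sub}(\mathcal{O})$ is the set of subconcepts of concepts in $\mathcal{O}$, and for an $\mathcal{EL}_\bot$ ontology $\mathcal{O}'$, $\mathsf{CL}(\mathcal{O}')=\{\langle C,D\rangle\mid C,D\in\mathsf{sub}(\mathcal{O}'),\mathcal{O}'\models C\sqsubseteq D\}$. $\mathcal{C}(\mathcal{O})$ is the set of constraints in $\mathcal{O}$; $\mathcal{O}^{ -\mathcal{D}}$ and $C^{ -\mathcal{D}}$ are obtained from $\mathcal{O}$ and $C$ by replacing each constraint $\alpha\in\mathcal{C}(\mathcal{O})$ by a fresh concept name $A_\alpha$. **Algorithm 1.** Start with $\mathcal{O}':=\mathcal{O}^{ -\mathcal{D}}$, $\mathcal{N}:=\emptyset$. While $\mathcal{N}\neq\mathsf{CL}(\mathcal{O}')$: set $\mathcal{N}:=\mathsf{CL}(\mathcal{O}')$, and for each $C\in\mathsf{sub}(\mathcal{O}^{ -\mathcal{D}})$ let $\mathbf{D}_C:=\{\alpha\in\mathcal{C}(\mathcal{O})\mid\langle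 C,A_\alpha\rangle\in\mathsf{CL}(\mathcal{O}')\}$, and write $\mathbf{D}_C=\{\alpha_1,\dots,\alpha_k\}$ (if $k=0$, the conjunction $A_{\alpha_1}\sqcap\dots\sqcap A_{\alpha_k}$ is $\top$); if $\mathcal{D}\models\bigwedge\mathbf{D}_C\to\bot$, add $A_{\alpha_1}\sqcap\dots\sqcap A_{\alpha_k}\sqsubseteq\bot$ to $\mathcal{O}'$; otherwise add all $A_{\alpha_1}\sqcap\dots\sqcap A_{\alpha_k}\sqsubseteq A_\beta$ with $\beta\in\mathcal{C}(\mathcal{O})$ and $\mathcal{D}\models\bigwedge\mathbf{D}_C\to\beta$. The $\mathcal{D}$-implications used in an Elk-proof over $\mathcal{O}'$ are those $\bigwedge\mathbf{D}_C\to\beta$ (with $\beta=\bot$ allowed) whose corresponding added axioms occur as leaves of the proof. **Proofs.** A proof is a finite directed labeled hypergraph $(V,E,\ell)$ whose hyperedges $(S,d)\in E$ ($S\subseteq V$ premises, $d\in V$ conclusion) are inferences, such that the relation $\{(s,d)\mid(S,d)\in E,s\in S\}$ has no cycles, there is a unique sink (a vertex that is no premise), labeled by the final conclusion, and no two distinct hyperedges have conclusions with the same label. Leaves are vertices without incoming hyperedge; a hyperedge with $S=\emptyset$ is an inference without premises. - An *Elk-proof* for $\mathcal{O}'\models\eta$ has leaves labeled by axioms of $\mathcal{O}'$, sink $\eta$, and all inferences are instances of the rules of the $\mathcal{EL}_\bot$ calculus used by the reasoner Elk: $\mathsf{R}_0$: $C\sqsubseteq C$ (no premise); $\mathsf{R}_\top$: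 $C\sqsubseteq\top$ (no premise); $\mathsf{R}_\sqsubseteq$: from $C\sqsubseteq D$ and $D\sqsubseteq E$ infer $C\sqsubseteq E$, where $D\sqsubseteq E$ must be an element of the input ontology; $\mathsf{R}_\sqcap^-$: from $C\sqsubseteq D_1\sqcap\dots\sqcap D_n$ infer $C\sqsubseteq D_i$; $\mathsf{R}_\sqcap^+$: from $C\sqsubseteq D$ and $C\sqsubseteq E$ infer $C\sqsubseteq D\sqcap E$; $\mathsf{R}_\exists$: from $C\sqsubseteq\exists r.D$ and $D\sqsubseteq E$ infer $C\sqsubseteq\exists r.E$; $\mathsf{R}_\bot$: from $C\sqsubseteq\exists r.D$ and $D\sqsubseteq\bot$ infer $C\sqsubseteq\bot$. - A *$\mathcal{D}$-proof* of $\alpha_1\wedge\dots\wedge\alpha_n\to\beta$ has vertices labeled by constraints, leaves labeled by constraints among $\alpha_1,\dots,\alpha_n$, sink $\beta$, and each inference with premises $\gamma_1,\dots,\gamma_m$ and conclusion $\delta$ satisfies $\mathcal{D}\models\gamma_1\wedge\dots\wedge\gamma_m\to\delta$. - An *$\mathcal{EL}_\bot[\mathcal{D}]$-proof* for $\mathcal{O}\models\eta$ has leaves labeled by axioms of $\mathcal{O}$, sink $\eta$, and each inference is either an instance of one of the Elk rules $\mathsf{R}_0$, $\mathsf{R}_\top$, $\mathsf{R}_\sqsubseteq$, $\mathsf{R}_\sqcap^-$, $\mathsf{R}_\sqcap^+$, $\mathsf{R}_\exists$, $\mathsf{R}_\bot$ (with $\mathcal{EL}_\bot[\mathcal{D}]$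 concepts and input ontology $\mathcal{O}$), or a concrete domain inference with a DL context $C$: from $C\sqsubseteq[\gamma_1],\dots,C\sqsubseteq[\gamma_m]$ infer $C\sqsubseteq[\delta]$, where $\mathcal{D}\models\gamma_1\wedge\dots\wedge\gamma_m\to\delta$ and $C$ is an $\mathcal{EL}_\bot[\mathcal{D}]$ concept. -}

module Defs where

open import Level using (Level; _⊔_)
open import Data.Bool.Base using (Bool; true; false)
open import Data.Empty using () renaming (⊥ to Empty)
open import Data.Fin.Base using (Fin; toℕ)
open import Data.Fin.Subset using (Subset) renaming (_∈_ to _∈ˢ_; _∉_ to _∉ˢ_)
open import Data.List.Base using (List; []; _∷_; map; _++_; concatMap; allFin)
open import Data.List.Membership.Propositional using (_∈_)
open import Data.List.Relation.Unary.All using (All)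
open import Data.List.Relation.Unary.Any using (Any)
open import Data.List.Relation.Unary.Unique.Propositional using (Unique)
open import Data.Nat.Base using (ℕ; zero; suc; _+_; _*_; _≤_)
open import Data.Product.Base using (Σ; Σ-syntax; ∃-syntax; _×_; _,_)
open import Data.Sum.Base using (_⊎_; inj₁; inj₂)
open import Data.Unit.Base using () renaming (⊤ to Unit)
open import Data.Vec.Base as Vec using (Vec)
open import Function.Bundles using (_⇔_)
open import Function.Definitions using (Injective)
open import Relation.Binary.Construct.Closure.Transitive using (TransClosure)
open import Relation.Binary.PropositionalEquality using (_≡_; _≢_)
open import Relation.Nullary using (¬_)

private
  variable
    ℓ : Level
    A B : Set

-- Programs in the style of Jones' language WHILE, transforming binary
-- trees.  A program is a combinator acting on a single tree, which serves
-- as its store.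

infixr 5 _∙_

data 𝔻 : Set where
  nil : 𝔻
  _∙_ : 𝔻 → 𝔻 → 𝔻

size : 𝔻 → ℕ
size nil     = 1
size (x ∙ y) = suc (size x + size y)

accept reject : 𝔻
accept = nil ∙ nil
reject = nil

infixr 4 _⨾_

data Prog : Set where
  id nil hd tl eq : Prog
  _⨾_             : Prog → Prog → Prog
  ⟨_,_⟩           : Prog → Prog → Prog
  ifelse          : Prog → Prog → Prog → Prog
  while           : Prog → Prog → Prog

infix 3 _⊢_⇓[_]_

-- p ⊢ x ⇓[ t ] y : on input x, program p halts after t steps with output y.
-- Comparing trees and duplicating the input (in ⟨_,_⟩) are charged for the
-- size of the input.  Hence size y ≤ size x + t: no large trees can be built
-- cheaply by sharing, and running time agrees with that of Turing machines
-- up to a polynomial.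

data _⊢_⇓[_]_ : Prog → 𝔻 → ℕ → 𝔻 → Set where
  id     : ∀ {x}   → id  ⊢ x     ⇓[ 1 ] x
  nil    : ∀ {x}   → nil ⊢ x     ⇓[ 1 ] nil
  hd-nil :           hd  ⊢ nil   ⇓[ 1 ] nil
  hd     : ∀ {x y} → hd  ⊢ x ∙ y ⇓[ 1 ] x
  tl-nil :           tl  ⊢ nil   ⇓[ 1 ] nil
  tl     : ∀ {x y} → tl  ⊢ x ∙ y ⇓[ 1 ] y
  eq-nil :           eq  ⊢ nil   ⇓[ 1 ] reject
  eq-yes : ∀ {x}   → eq  ⊢ x ∙ x ⇓[ size (x ∙ x) ] accept
  eq-no  : ∀ {x y} → x ≢ y → eq ⊢ x ∙ y ⇓[ size (x ∙ y) ] reject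
  seq    : ∀ {p q x y z s t} →
           p ⊢ x ⇓[ s ] y → q ⊢ y ⇓[ t ] z →
           p ⨾ q ⊢ x ⇓[ suc (s + t) ] z
  pair   : ∀ {p q x y z s t} →
           p ⊢ x ⇓[ s ] y → q ⊢ x ⇓[ t ] z →
           ⟨ p , q ⟩ ⊢ x ⇓[ suc (size x + s + t) ] y ∙ z
  then   : ∀ {c p q x a b y s t} →
           c ⊢ x ⇓[ s ] a ∙ b → p ⊢ x ⇓[ t ] y →
           ifelse c p q ⊢ x ⇓[ suc (s + t) ] y
  else   : ∀ {c p q x y s t} →
           c ⊢ x ⇓[ s ] nil → q ⊢ x ⇓[ t ] y →
           ifelse c p q ⊢ x ⇓[ suc (s + t) ] y
  stop   : ∀ {c p x s} →
           c ⊢ x ⇓[ s ] nil →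
           while c p ⊢ x ⇓[ suc s ] x
  loop   : ∀ {c p x a b y z s t u} →
           c ⊢ x ⇓[ s ] a ∙ b → p ⊢ x ⇓[ t ] y → while c p ⊢ y ⇓[ u ] z →
           while c p ⊢ x ⇓[ suc (s + t + u) ] z

infixl 6 _⊕_
infixl 7 _⊗_

data Poly : Set where
  X       : Poly
  const   : ℕ → Poly
  _⊕_ _⊗_ : Poly → Poly → Poly

evalPoly : Poly → ℕ → ℕ
evalPoly X         n = n
evalPoly (const k) n = k
evalPoly (f ⊕ g)   n = evalPoly f n + evalPoly g n
evalPoly (f ⊗ g)   n = evalPoly f n * evalPoly g n

infix 3 _⊢_⇓_within_

_⊢_⇓_within_ : Prog → 𝔻 → 𝔻 → Poly → Set
p ⊢ x ⇓ y within f = ∃[ t ] (p ⊢ x ⇓[ t ] y) × t ≤ evalPoly f (size x)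

DecidableInPolyTime : (A → 𝔻) → (A → Set) → Set
DecidableInPolyTime {A} code P =
  Σ[ p ∈ Prog ] Σ[ f ∈ Poly ] ∀ (a : A) →
    (P a × (p ⊢ code a ⇓ accept within f)) ⊎ (¬ P a × (p ⊢ code a ⇓ reject within f))

codeℕ : ℕ → 𝔻
codeℕ zero    = nil
codeℕ (suc n) = nil ∙ codeℕ n

codeBool : Bool → 𝔻
codeBool true  = accept
codeBool false = reject

codeList : (A → 𝔻) → List A → 𝔻
codeList c []       = nil
codeList c (x ∷ xs) = c x ∙ codeList c xs

codeProduct : (A → 𝔻) → (B → 𝔻) → A × B → 𝔻
codeProduct c d (x , y) = c x ∙ d y

codeSum : (A → 𝔻) → (B → 𝔻) → A ⊎ B → 𝔻
codeSum c d (inj₁ x) = codeℕ 0 ∙ c x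
codeSum c d (inj₂ y) = codeℕ 1 ∙ d y

record Hypergraph (L : Set) : Set where
  field
    #V    : ℕ
    label : Fin #V → L
    edges : List (Subset #V × Fin #V)

  IsLeaf : Fin #V → Set
  IsLeaf v = ∀ S d → (S , d) ∈ edges → d ≢ v

  IsSink : Fin #V → Set
  IsSink v = ∀ S d → (S , d) ∈ edges → v ∉ˢ S

  Premise : Fin #V → Fin #V → Set
  Premise s d = ∃[ S ] (S , d) ∈ edges × s ∈ˢ S

codeHypergraph : (A → 𝔻) → Hypergraph A → 𝔻
codeHypergraph c G =
  codeList c (map label (allFin #V)) ∙
  codeList (codeProduct (λ S → codeList codeBool (Vec.toList S))
                        (λ d → codeℕ (toℕ d)))
           edges
  where open Hypergraph G

record IsProof {L : Set} (Leaf : L → Set) (Rule : List L → L → Set)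
               (goal : L) (G : Hypergraph L) : Set where
  open Hypergraph G
  field
    acyclic    : ∀ v → ¬ TransClosure Premise v v
    sink       : Fin #V
    sink-sink  : IsSink sink
    sink-only  : ∀ v → IsSink v → v ≡ sink
    sink-label : label sink ≡ goal
    unique     : ∀ S d S′ d′ → (S , d) ∈ edges → (S′ , d′) ∈ edges →
                 label d ≡ label d′ → (S , d) ≡ (S′ , d′)
    leaves     : ∀ v → IsLeaf v → Leaf (label v)
    -- The rules take a list of premises, so the premise set of a hyperedge
    -- has to be enumerated, possibly with repetitions: for instance, the two
    -- premises of a conjunction introduction may be the same vertex.
    inferences : ∀ S d → (S , d) ∈ edges →
                 Σ[ vs ∈ List (Fin #V) ]
                   (∀ v → v ∈ˢ S ⇔ v ∈ vs) × Rule (map label vs) (label d)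

_Enumerates_ : List A → (A → Set ℓ) → Set ℓ
xs Enumerates P = ∀ x → x ∈ xs ⇔ P x

-- Names and variables are objects that an algorithm can read and compare.

record Signature : Set₁ where
  field
    ConceptName RoleName Var : Set
    codeConceptName          : ConceptName → 𝔻
    codeRoleName             : RoleName → 𝔻
    codeVar                  : Var → 𝔻
    conceptName-injective    : Injective _≡_ _≡_ codeConceptName
    roleName-injective       : Injective _≡_ _≡_ codeRoleName
    var-injective            : Injective _≡_ _≡_ codeVar

-- Pred k is the set of k-ary predicates other than the nullary predicate ⊥,
-- which is adjoined in Constraint below.  Deciding validity algorithmically
-- presupposes a representation of predicates, given by codePred.

record ConcreteDomain : Set₁ where
  field
    Δ              : Set
    Pred           : ℕ → Set
    rel            : ∀ {k} → Pred k → Vec Δ k → Set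
    ⊤ᵖ             : Pred 1
    ⊤ᵖ-full        : ∀ d → rel ⊤ᵖ d
    codePred       : Σ ℕ Pred → 𝔻
    pred-injective : Injective _≡_ _≡_ codePred

module Logic (S : Signature) (𝒟 : ConcreteDomain) where

  open Signature S
  open ConcreteDomain 𝒟

  record Atom : Set where
    constructor _·_
    field
      {arity}   : ℕ
      predicate : Pred arity
      variables : Vec Var arity

  data Constraint : Set where
    ⊥ᵖ   : Constraint
    atom : Atom → Constraint

  Satisfies : (Var → Δ) → Constraint → Set
  Satisfies x ⊥ᵖ              = Empty
  Satisfies x (atom (P · xs)) = rel P (Vec.map x xs)

  infix 4 ⊨_⇒_

  ⊨_⇒_ : List Constraint → List Constraint → Set
  ⊨ γ ⇒ δ = ∀ (x : Var → Δ) → All (Satisfies x) γ → Any (Satisfies x) δ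

  codeAtom : Atom → 𝔻
  codeAtom (P · xs) = codePred (_ , P) ∙ codeList codeVar (Vec.toList xs)

  codeConstraint : Constraint → 𝔻
  codeConstraint ⊥ᵖ       = nil
  codeConstraint (atom α) = nil ∙ codeAtom α

  -- The empty disjunction is excluded from convexity: otherwise the valid
  -- implication from ⊥ᵖ to it would refute convexity of every domain.

  record PAdmissible : Set where
    field
      validity : DecidableInPolyTime
                   (codeProduct (codeList codeConstraint) (codeList codeConstraint))
                   (λ (γ , δ) → ⊨ γ ⇒ δ)
      convex   : ∀ γ δ → δ ≢ [] → ⊨ γ ⇒ δ → ∃[ α ] α ∈ δ × (⊨ γ ⇒ α ∷ [])

  -- Concepts over concept names in N and constraints in K.

  infixr 6 _⊓_

  data Concept (N K : Set) : Set where
    ⊤ ⊥  : Concept N K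
    name : N → Concept N K
    [_]  : K → Concept N K
    _⊓_  : Concept N K → Concept N K → Concept N K
    some : RoleName → Concept N K → Concept N K

  infix 4 _⊑_

  record Axiom (N K : Set) : Set where
    constructor _⊑_
    field
      lhs rhs : Concept N K

  Ontology : (N K : Set) → Set
  Ontology N K = List (Axiom N K)

  ⨅ : ∀ {N K} → List (Concept N K) → Concept N K
  ⨅ []           = ⊤
  ⨅ (C ∷ [])     = C
  ⨅ (C ∷ D ∷ Ds) = C ⊓ ⨅ (D ∷ Ds)

  sub : ∀ {N K} → Concept N K → List (Concept N K)
  sub C@(D ⊓ E)    = C ∷ sub D ++ sub E
  sub C@(some r D) = C ∷ sub D
  sub C            = C ∷ []

  subᴼ : ∀ {N K} → Ontology N K → List (Concept N K)
  subᴼ = concatMap (λ (C ⊑ D) → sub C ++ sub D)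

  constraints : ∀ {N K} → Concept N K → List K
  constraints [ α ]      = α ∷ []
  constraints (C ⊓ D)    = constraints C ++ constraints D
  constraints (some r C) = constraints C
  constraints _          = []

  𝒞 : ∀ {N K} → Ontology N K → List K
  𝒞 = concatMap (λ (C ⊑ D) → constraints C ++ constraints D)

  -- ELD is the set of concepts of EL⊥[𝒟].  Since [⊥ᵖ] is identified with ⊥,
  -- only constraints other than ⊥ᵖ need a concept of their own.  EL is the set
  -- of EL⊥ concepts, where inj₂ α is the fresh concept name for α.

  ELD EL : Set
  ELD = Concept ConceptName Atom
  EL  = Concept (ConceptName ⊎ Atom) Empty

  ELDAxiom ELAxiom ELDOntology ELOntology : Set
  ELDAxiom    = Axiom ConceptName Atom
  ELAxiom     = Axiom (ConceptName ⊎ Atom) Empty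
  ELDOntology = Ontology ConceptName Atom
  ELOntology  = Ontology (ConceptName ⊎ Atom) Empty

  concept : Constraint → ELD
  concept ⊥ᵖ       = ⊥
  concept (atom α) = [ α ]

  abstraction : Constraint → EL
  abstraction ⊥ᵖ       = ⊥
  abstraction (atom α) = name (inj₂ α)

  infix 8 _⁻ _⁻ᴼ

  _⁻ : ELD → EL
  ⊤ ⁻          = ⊤
  ⊥ ⁻          = ⊥
  (name A) ⁻   = name (inj₁ A)
  [ α ] ⁻      = abstraction (atom α)
  (C ⊓ D) ⁻    = C ⁻ ⊓ D ⁻
  (some r C) ⁻ = some r (C ⁻)

  _⁻ᴼ : ELDOntology → ELOntology
  O ⁻ᴼ = map (λ (C ⊑ D) → C ⁻ ⊑ D ⁻) O

  record Interpretation : Set₁ where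
    field
      Dom         : Set
      inhabitant  : Dom
      conceptName : ConceptName ⊎ Atom → Dom → Set
      roleName    : RoleName → Dom → Dom → Set

    ⟦_⟧ : EL → Dom → Set
    ⟦ ⊤ ⟧        d = Unit
    ⟦ ⊥ ⟧        d = Empty
    ⟦ name A ⟧   d = conceptName A d
    ⟦ C ⊓ D ⟧    d = ⟦ C ⟧ d × ⟦ D ⟧ d
    ⟦ some r C ⟧ d = ∃[ e ] roleName r d e × ⟦ C ⟧ e

    Models : ELAxiom → Set
    Models (C ⊑ D) = ∀ d → ⟦ C ⟧ d → ⟦ D ⟧ d

  infix 4 _⊩_

  _⊩_ : ELOntology → ELAxiom → Set₁
  O ⊩ η = (I : Interpretation) → let open Interpretation I in
          (∀ η′ → η′ ∈ O → Models η′) → Models η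

  CL : ELOntology → EL × EL → Set₁
  CL O (C , D) = C ∈ subᴼ O × D ∈ subᴼ O × (O ⊩ (C ⊑ D))

  -- The completion algorithm as a nondeterministic transition system.  The
  -- enumerations of the finite sets that it traverses are arbitrary.  The
  -- state is the list of 𝒟-implications whose axioms have been added so far;
  -- completed turns it into the current ontology.

  Implication : Set
  Implication = List Atom × Constraint

  implicationAxiom : Implication → ELAxiom
  implicationAxiom (αs , β) =
    ⨅ (map (λ α → abstraction (atom α)) αs) ⊑ abstraction β

  module Algorithm (O : ELDOntology) where

    completed : List Implication → ELOntology
    completed I = O ⁻ᴼ ++ map implicationAxiom I

    𝐃 : List Implication → EL → Atom → Set₁
    𝐃 I C α = α ∈ 𝒞 O × CL (completed I) (C , abstraction (atom α))

    data Visit (I : List Implication) (C : EL) : List Implication → Set₁ where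
      inconsistent : ∀ {αs} → Unique αs → αs Enumerates 𝐃 I C →
        ⊨ map atom αs ⇒ ⊥ᵖ ∷ [] →
        Visit I C ((αs , ⊥ᵖ) ∷ I)
      consistent : ∀ {αs βs} → Unique αs → αs Enumerates 𝐃 I C →
        ¬ (⊨ map atom αs ⇒ ⊥ᵖ ∷ []) →
        βs Enumerates (λ β → β ∈ 𝒞 O × (⊨ map atom αs ⇒ atom β ∷ [])) →
        Visit I C (map (λ β → αs , atom β) βs ++ I)

    data ForEach : List EL → List Implication → List Implication → Set₁ where
      done : ∀ {I} → ForEach [] I I
      next : ∀ {C Cs I J K} → Visit I C J → ForEach Cs J K → ForEach (C ∷ Cs) I K

    -- The first argument is the variable 𝒩 of the algorithm.

    data While : List (EL × EL) → List Implication → List Implication → Set₁ where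
      exit    : ∀ {𝒩 I} → 𝒩 Enumerates CL (completed I) → While 𝒩 I I
      iterate : ∀ {𝒩 𝒩′ Cs I J K} →
        ¬ (𝒩 Enumerates CL (completed I)) →
        𝒩′ Enumerates CL (completed I) →
        Unique Cs → Cs Enumerates (_∈ subᴼ (O ⁻ᴼ)) →
        ForEach Cs I J → While 𝒩′ J K →
        While 𝒩 I K

    Result : List Implication → Set₁
    Result I = While [] [] I

  open Algorithm public

  data ElkRule {N K : Set} (O : Ontology N K) : List (Axiom N K) → Axiom N K → Set where
    R₀  : ∀ {C} → ElkRule O [] (C ⊑ C)
    R⊤  : ∀ {C} → ElkRule O [] (C ⊑ ⊤)
    R⊑  : ∀ {C D E} → (D ⊑ E) ∈ O → ElkRule O ((C ⊑ D) ∷ (D ⊑ E) ∷ []) (C ⊑ E)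
    R⊓⁻ : ∀ {C D Ds} → D ∈ Ds → ElkRule O ((C ⊑ ⨅ Ds) ∷ []) (C ⊑ D)
    R⊓⁺ : ∀ {C D E} → ElkRule O ((C ⊑ D) ∷ (C ⊑ E) ∷ []) (C ⊑ D ⊓ E)
    R∃  : ∀ {C D E r} → ElkRule O ((C ⊑ some r D) ∷ (D ⊑ E) ∷ []) (C ⊑ some r E)
    R⊥  : ∀ {C D r} → ElkRule O ((C ⊑ some r D) ∷ (D ⊑ ⊥) ∷ []) (C ⊑ ⊥)

  data ELDRule (O : ELDOntology) : List ELDAxiom → ELDAxiom → Set where
    elk : ∀ {ηs η} → ElkRule O ηs η → ELDRule O ηs η
    cd  : ∀ {C γs δ} → ⊨ γs ⇒ δ ∷ [] →
          ELDRule O (map (λ γ → C ⊑ concept γ) γs) (C ⊑ concept δ)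

  IsElkProof : ELOntology → ELAxiom → Hypergraph ELAxiom → Set
  IsElkProof O = IsProof (_∈ O) (ElkRule O)

  IsDProof : Implication → Hypergraph Constraint → Set
  IsDProof (αs , β) = IsProof (_∈ map atom αs) (λ γs δ → ⊨ γs ⇒ δ ∷ []) β

  IsELDProof : ELDOntology → ELDAxiom → Hypergraph ELDAxiom → Set
  IsELDProof O = IsProof (_∈ O) (ELDRule O)

  UsedIn : Hypergraph ELAxiom → Implication → Set
  UsedIn G ι = ∃[ v ] IsLeaf v × label v ≡ implicationAxiom ι
    where open Hypergraph G

  codeConcept : ∀ {N K} → (N → 𝔻) → (K → 𝔻) → Concept N K → 𝔻
  codeConcept n k ⊤          = codeℕ 0 ∙ nil
  codeConcept n k ⊥          = codeℕ 1 ∙ nil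
  codeConcept n k (name A)   = codeℕ 2 ∙ n A
  codeConcept n k [ α ]      = codeℕ 3 ∙ k α
  codeConcept n k (C ⊓ D)    = codeℕ 4 ∙ codeConcept n k C ∙ codeConcept n k D
  codeConcept n k (some r C) = codeℕ 5 ∙ codeRoleName r ∙ codeConcept n k C

  codeELD : ELD → 𝔻
  codeELD = codeConcept codeConceptName codeAtom

  codeEL : EL → 𝔻
  codeEL = codeConcept (codeSum codeConceptName codeAtom) (λ ())

  codeELDAxiom : ELDAxiom → 𝔻
  codeELDAxiom (C ⊑ D) = codeELD C ∙ codeELD D

  codeELAxiom : ELAxiom → 𝔻
  codeELAxiom (C ⊑ D) = codeEL C ∙ codeEL D

  codeImplication : Implication → 𝔻
  codeImplication = codeProduct (codeList codeAtom) codeConstraint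

  codeInput : ELDOntology → ELD → ELD → Hypergraph ELAxiom →
              List (Implication × Hypergraph Constraint) → 𝔻
  codeInput O C D P′ Qs =
    codeList codeELDAxiom O ∙ codeELD C ∙ codeELD D ∙
    codeHypergraph codeELAxiom P′ ∙
    codeList (codeProduct codeImplication (codeHypergraph codeConstraint)) Qs

  codeOutput : Hypergraph ELDAxiom → 𝔻
  codeOutput = codeHypergraph codeELDAxiom

{-# OPTIONS --safe #-}

-- Whether C ⊑ D has a proof over O can be decided by saturation over O alone:
-- only the subconcepts of O, C and D matter, and the concrete domain inferences
-- are supplied by the polynomial-time validity test of the p-admissible domain.
-- Each axiom found is recorded with an inference from axioms found earlier, so
-- that dropping the lines on which C ⊑ D does not depend leaves an acyclic proof
-- with a unique sink.  The given Elk-proof only serves to show that C ⊑ D is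
-- found: its rules are sound in the canonical model of the saturation, and so
-- are the axioms added by Algorithm 1, as they stem from valid implications.

module Submission where

open import Data.Bool.Base using (Bool; true; false; if_then_else_; _∧_; _∨_)
open import Data.Empty using (⊥-elim)
open import Data.Fin.Base using (Fin; zero; suc; toℕ)
open import Data.Fin.Induction using (spo-wellFounded)
open import Data.Fin.Properties using () renaming (_≟_ to _≟ᶠ_)
open import Data.Fin.Subset using (Subset) renaming (_∈_ to _∈ˢ_)
open import Data.List.Base
  using (List; []; _∷_; map; foldr; foldl; reverse; length; _ʳ++_; _++_; concatMap; concat; take; lookup;
         tabulate; allFin)
open import Data.List.Properties
open import Data.List.Membership.Propositional using (_∈_; _∉_; find; lose)
open import Data.List.Membership.Propositional.Properties
  using (∈-++⁺ˡ; ∈-++⁺ʳ; ∈-++⁻; ∈-map⁺; ∈-map⁻; ∈-concatMap⁺; ∈-concatMap⁻; ∈-∃++; ∈-allFin)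
import Data.List.Membership.DecPropositional as DecPropositional
open import Data.List.Relation.Binary.Subset.Propositional using (_⊆_)
open import Data.List.Relation.Unary.All as All using (All; []; _∷_)
import Data.List.Relation.Unary.All.Properties as AllP
open import Data.List.Relation.Unary.Any using (Any; here; there; index; any?)
open import Data.List.Relation.Unary.Any.Properties using (¬Any[]; lookup-index)
open import Data.Nat.Base using (ℕ; zero; suc; _+_; _*_; _≤_; _<_; z≤n; s≤s; s≤s⁻¹)
open import Data.Nat.Properties
  using (m≤m+n; m≤n+m; n≤1+n; ≤-trans; ≤-refl; ≤-reflexive; +-mono-≤; +-monoˡ-≤; +-monoʳ-≤; *-mono-≤;
         +-assoc; +-comm; +-suc; n≮0; n≮n; <-trans; 1+n≰n; _≤?_; ≰⇒>; module ≤-Reasoning)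
import Data.Nat.Tactic.RingSolver as ℕ-solver
open import Data.Product.Base using (Σ-syntax; ∃-syntax; _×_; _,_; proj₁; proj₂)
open import Data.Sum.Base using (_⊎_; inj₁; inj₂)
open import Data.Unit.Base using () renaming (⊤ to Unit)
open import Data.Vec.Base as Vec using ()
open import Data.Vec.Properties using (toList-injective; cast-is-id; lookup∘tabulate; []=⇒lookup; lookup⇒[]=)
open import Function.Bundles using (_⇔_; mk⇔; Equivalence)
open import Induction.WellFounded using (WellFounded; Acc; acc)
open import Relation.Binary.Construct.Closure.Transitive using (TransClosure; [_]; _∷_; transitive)
open import Relation.Binary.Definitions using (DecidableEquality)
open import Relation.Binary.PropositionalEquality
open import Relation.Nullary.Decidable using (dec-true)
open import Relation.Nullary using (Dec; yes; no; does; map′; _×-dec_)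
open import Defs

-- Polynomial time

-- The program is fixed before the ontology, and running time is counted on trees, so every function
-- of the construction is assembled from combinators carrying a program, a polynomial and a proof
-- that they fit. The delicate one is the fold: iterating a polynomial-time step may blow up the
-- accumulator, so each fold comes with a bound on the growth per step that does not depend on the
-- accumulator. Saturation meets the side conditions on hypergraphs. If 𝒟-proofs were spliced into
-- the Elk-proof, a label could be concluded at several places and premises could become circular; a
-- saturation finds each axiom once, after its premises. A concrete domain inference could have
-- exponentially many premise sets. As validity is monotone in the premises, it is enough to try the
-- set of all constraints known for the context. The Elk-proof may pass through concepts outside the
-- finite set of candidates, such as new conjunctions. Its soundness is therefore shown for a
-- forcing relation defined on all concepts, which is compared with membership in the saturation for
-- candidates only.

size≥1 : ∀ x → 1 ≤ size x
size≥1 nil     = s≤s z≤n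
size≥1 (_ ∙ _) = s≤s z≤n

-- Only `pair` duplicates its input, and it is charged for the size of the input. The bound turns a
-- time bound into an output bound, which is what makes polynomial times compose.
⇓-size : ∀ {p x t y} → p ⊢ x ⇓[ t ] y → size y ≤ size x + t
⇓-size id = m≤m+n _ _
⇓-size {x = x} nil = m≤n+m 1 (size x)
⇓-size hd-nil = s≤s z≤n
⇓-size (hd {x} {y}) = ≤-trans (m≤m+n (size x) (size y)) (≤-trans (n≤1+n _) (m≤m+n _ 1))
⇓-size tl-nil = s≤s z≤n
⇓-size (tl {x} {y}) = ≤-trans (m≤n+m (size y) (size x)) (≤-trans (n≤1+n _) (m≤m+n _ 1))
⇓-size eq-nil = s≤s z≤n
⇓-size (eq-yes {x}) = s≤s (+-mono-≤ {1} {size x + size x} (≤-trans (size≥1 x) (m≤m+n _ _)) (s≤s z≤n))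
⇓-size (eq-no {x} {y} _) = s≤s z≤n
⇓-size (seq {x = x} {y} {z} {s} {t} P Q) = begin
  size z           ≤⟨ ⇓-size Q ⟩
  size y + t       ≤⟨ +-monoˡ-≤ t (⇓-size P) ⟩
  size x + s + t   ≡⟨ +-assoc (size x) s t ⟩
  size x + (s + t) ≤⟨ +-monoʳ-≤ (size x) (n≤1+n _) ⟩
  size x + suc (s + t) ∎
  where open ≤-Reasoning
⇓-size (pair {x = x} {y} {z} {s} {t} P Q) = begin
  suc (size y + size z)               ≤⟨ s≤s (+-mono-≤ (⇓-size P) (⇓-size Q)) ⟩
  suc (size x + s + (size x + t))     ≡⟨ lemma (size x) s t ⟩
  size x + suc (size x + s + t) ∎
  where
  open ≤-Reasoning
  lemma : ∀ n s t → suc (n + s + (n + t)) ≡ n + suc (n + s + t)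
  lemma = ℕ-solver.solve-∀
⇓-size (then {x = x} {s = s} {t} _ Q) =
  ≤-trans (⇓-size Q) (+-monoʳ-≤ (size x) (≤-trans (m≤n+m t s) (n≤1+n _)))
⇓-size (else {x = x} {s = s} {t} _ Q) =
  ≤-trans (⇓-size Q) (+-monoʳ-≤ (size x) (≤-trans (m≤n+m t s) (n≤1+n _)))
⇓-size (stop _) = m≤m+n _ _
⇓-size (loop {x = x} {y = y} {z} {s} {t} {u} _ P Q) = begin
  size z                   ≤⟨ ⇓-size Q ⟩
  size y + u               ≤⟨ +-monoˡ-≤ u (⇓-size P) ⟩
  size x + t + u           ≡⟨ +-assoc (size x) t u ⟩
  size x + (t + u)         ≤⟨ +-monoʳ-≤ (size x) (+-monoˡ-≤ u (m≤n+m t s)) ⟩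
  size x + (s + t + u)     ≤⟨ +-monoʳ-≤ (size x) (n≤1+n _) ⟩
  size x + suc (s + t + u) ∎
  where open ≤-Reasoning

evalPoly-mono : ∀ f {m n} → m ≤ n → evalPoly f m ≤ evalPoly f n
evalPoly-mono X         m≤n = m≤n
evalPoly-mono (const k) m≤n = ≤-refl
evalPoly-mono (f ⊕ g)   m≤n = +-mono-≤ (evalPoly-mono f m≤n) (evalPoly-mono g m≤n)
evalPoly-mono (f ⊗ g)   m≤n = *-mono-≤ (evalPoly-mono f m≤n) (evalPoly-mono g m≤n)

infixl 8 _⟨_⟩

_⟨_⟩ : Poly → Poly → Poly
X       ⟨ g ⟩ = g
const k ⟨ g ⟩ = const k
(f ⊕ h) ⟨ g ⟩ = f ⟨ g ⟩ ⊕ h ⟨ g ⟩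
(f ⊗ h) ⟨ g ⟩ = f ⟨ g ⟩ ⊗ h ⟨ g ⟩

evalPoly-⟨⟩ : ∀ f g n → evalPoly (f ⟨ g ⟩) n ≡ evalPoly f (evalPoly g n)
evalPoly-⟨⟩ X         g n = refl
evalPoly-⟨⟩ (const k) g n = refl
evalPoly-⟨⟩ (f ⊕ h)   g n = cong₂ _+_ (evalPoly-⟨⟩ f g n) (evalPoly-⟨⟩ h g n)
evalPoly-⟨⟩ (f ⊗ h)   g n = cong₂ _*_ (evalPoly-⟨⟩ f g n) (evalPoly-⟨⟩ h g n)

-- Polynomial-time functions and their combinators

-- The program is specified on codes of elements of `A` only; its behaviour on other trees is left
-- open.
record PolyTime {A B : Set} (a : A → 𝔻) (b : B → 𝔻) (f : A → B) : Set where
  constructor polyTime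
  field
    program : Prog
    time    : Poly
    runs    : ∀ x → program ⊢ a x ⇓ b (f x) within time

  outputSize : Poly
  outputSize = X ⊕ time

  size-output : ∀ x → size (b (f x)) ≤ evalPoly outputSize (size (a x))
  size-output x = let _ , r , t≤ = runs x in
    ≤-trans (⇓-size r) (+-monoʳ-≤ (size (a x)) t≤)

open PolyTime

private
  variable
    A B C : Set
    a : A → 𝔻
    b : B → 𝔻
    c : C → 𝔻

-- Trees as their own codes: through `fromRaw` and `toRaw` a typed value can be taken apart and
-- rebuilt as a bare tree.
𝔻-id : 𝔻 → 𝔻
𝔻-id x = x

abstract
  polyTime-cong : {f g : A → B} → (∀ x → b (f x) ≡ b (g x)) → PolyTime a b f → PolyTime a b g
  polyTime-cong {a = a} f≗g F = polyTime (program F) (time F) λ x →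
    subst (λ y → program F ⊢ a x ⇓ y within time F) (f≗g x) (runs F x)

  fromRaw : {f : A → B} → PolyTime a 𝔻-id (λ x → b (f x)) → PolyTime a b f
  fromRaw (polyTime p f r) = polyTime p f r

  toRaw : {f : A → B} → PolyTime a b f → PolyTime a 𝔻-id (λ x → b (f x))
  toRaw (polyTime p f r) = polyTime p f r

  idᴾ : PolyTime a a (λ x → x)
  idᴾ = polyTime id (const 1) λ x → 1 , id , ≤-refl

infixl 5 _⟫_

abstract
  _⟫_ : {f : A → B} {g : B → C} → PolyTime a b f → PolyTime b c g → PolyTime a c (λ x → g (f x))
  _⟫_ {a = a} {f = f} F G = polyTime (program F ⨾ program G)
    (const 1 ⊕ (time F ⊕ time G ⟨ outputSize F ⟩)) λ x →
    let s , r , s≤ = runs F x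
        t , q , t≤ = runs G (f x)
    in _ , seq r q , s≤s (+-mono-≤ s≤ (≤-trans t≤ (≤-trans
         (evalPoly-mono (time G) (size-output F x))
         (≤-reflexive (sym (evalPoly-⟨⟩ (time G) (outputSize F) (size (a x))))))))

infixr 4 _,ᴾ_

abstract
  _,ᴾ_ : {f : A → B} {g : A → C} → PolyTime a b f → PolyTime a c g →
         PolyTime a (codeProduct b c) (λ x → f x , g x)
  F ,ᴾ G = polyTime ⟨ program F , program G ⟩ (const 1 ⊕ (X ⊕ time F ⊕ time G)) λ x →
    let s , r , s≤ = runs F x
        t , q , t≤ = runs G x
    in _ , pair r q , s≤s (+-mono-≤ (+-monoʳ-≤ _ s≤) t≤)

  π₁ : PolyTime (codeProduct a b) a proj₁
  π₁ = polyTime hd (const 1) λ x → 1 , hd , ≤-refl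

  π₂ : PolyTime (codeProduct a b) b proj₂
  π₂ = polyTime tl (const 1) λ x → 1 , tl , ≤-refl

  raw,ᴾ : {f g : A → 𝔻} → PolyTime a 𝔻-id f → PolyTime a 𝔻-id g →
          PolyTime a 𝔻-id (λ x → f x ∙ g x)
  raw,ᴾ F G = toRaw (F ,ᴾ G)

  constᴰ : ∀ d → PolyTime a 𝔻-id (λ _ → d)
  constᴰ nil     = polyTime nil (const 1) λ _ → 1 , nil , ≤-refl
  constᴰ (d ∙ e) = raw,ᴾ (constᴰ d) (constᴰ e)

  constᴾ : ∀ y → PolyTime a b (λ _ → y)
  constᴾ {b = b} y = fromRaw (constᴰ (b y))

head tail : 𝔻 → 𝔻
head nil     = nil
head (x ∙ y) = x
tail nil     = nil
tail (x ∙ y) = y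

abstract
  headᴾ : {f : A → 𝔻} → PolyTime a 𝔻-id f → PolyTime a 𝔻-id (λ x → head (f x))
  headᴾ F = F ⟫ polyTime {b = 𝔻-id} {f = head} hd (const 1) λ where
    nil     → 1 , hd-nil , ≤-refl
    (x ∙ y) → 1 , hd , ≤-refl

  tailᴾ : {f : A → 𝔻} → PolyTime a 𝔻-id f → PolyTime a 𝔻-id (λ x → tail (f x))
  tailᴾ F = F ⟫ polyTime {b = 𝔻-id} {f = tail} tl (const 1) λ where
    nil     → 1 , tl-nil , ≤-refl
    (x ∙ y) → 1 , tl , ≤-refl

branch : 𝔻 → B → B → B
branch nil     u v = v
branch (_ ∙ _) u v = u

abstract
  branchᴾ : {d : A → 𝔻} {f g : A → B} →
            PolyTime a 𝔻-id d → PolyTime a b f → PolyTime a b g →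
            PolyTime a b (λ x → branch (d x) (f x) (g x))
  branchᴾ {a = a} {b = b} {d = d} {f} {g} D F G =
    polyTime (ifelse (program D) (program F) (program G))
      (const 1 ⊕ (time D ⊕ (time F ⊕ time G))) λ x → go x (d x) (runs D x)
    where
    go : ∀ x y → program D ⊢ a x ⇓ y within time D →
         ifelse (program D) (program F) (program G) ⊢ a x ⇓ b (branch y (f x) (g x))
           within const 1 ⊕ (time D ⊕ (time F ⊕ time G))
    go x nil     (s , r , s≤) = let t , q , t≤ = runs G x in
      _ , else r q , s≤s (+-mono-≤ s≤ (≤-trans t≤ (m≤n+m _ _)))
    go x (_ ∙ _) (s , r , s≤) = let t , q , t≤ = runs F x in
      _ , then r q , s≤s (+-mono-≤ s≤ (≤-trans t≤ (m≤m+n _ _)))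

  ifᴾ : {d : A → Bool} {f g : A → B} →
        PolyTime a codeBool d → PolyTime a b f → PolyTime a b g →
        PolyTime a b (λ x → if d x then f x else g x)
  ifᴾ {b = b} {d = d} {f} {g} D F G = polyTime-cong (λ x → cong b (if-lemma (d x))) (branchᴾ (toRaw D) F G)
    where
    if-lemma : ∀ {u v : B} (t : Bool) → branch (codeBool t) u v ≡ (if t then u else v)
    if-lemma true  = refl
    if-lemma false = refl

_≟ᴰ_ : DecidableEquality 𝔻
nil     ≟ᴰ nil     = yes refl
nil     ≟ᴰ (_ ∙ _) = no λ ()
(_ ∙ _) ≟ᴰ nil     = no λ ()
(x ∙ y) ≟ᴰ (u ∙ v) = map′ (λ (p , q) → cong₂ _∙_ p q) (λ { refl → refl , refl }) (x ≟ᴰ u ×-dec y ≟ᴰ v)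

abstract
  eqᴾ : {f g : A → 𝔻} → PolyTime a 𝔻-id f → PolyTime a 𝔻-id g →
        PolyTime a codeBool (λ x → does (f x ≟ᴰ g x))
  eqᴾ F G = (F ,ᴾ G) ⟫ polyTime eq X λ (x , y) → go x y (x ≟ᴰ y)
    where
    go : ∀ x y (d : Dec (x ≡ y)) → eq ⊢ x ∙ y ⇓ codeBool (does d) within X
    go x .x (yes refl) = _ , eq-yes , ≤-refl
    go x y  (no  x≢y)  = _ , eq-no x≢y , ≤-refl

  ∧ᴾ : {f g : A → Bool} → PolyTime a codeBool f → PolyTime a codeBool g →
       PolyTime a codeBool (λ x → f x ∧ g x)
  ∧ᴾ {f = f} {g} F G = polyTime-cong (λ x → cong codeBool (if-lemma (f x) (g x))) (ifᴾ F G (constᴾ false))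
    where
    if-lemma : ∀ u v → (if u then v else false) ≡ u ∧ v
    if-lemma true  v = refl
    if-lemma false v = refl

  ∨ᴾ : {f g : A → Bool} → PolyTime a codeBool f → PolyTime a codeBool g →
       PolyTime a codeBool (λ x → f x ∨ g x)
  ∨ᴾ {f = f} {g} F G = polyTime-cong (λ x → cong codeBool (if-lemma (f x) (g x))) (ifᴾ F (constᴾ true) G)
    where
    if-lemma : ∀ u v → (if u then true else v) ≡ u ∨ v
    if-lemma true  v = refl
    if-lemma false v = refl

-- Loops

-- A total counterpart of `while`. The number caps the passes, which changes nothing once it is at
-- least a measure that every pass lowers.
iterateWhile : (A → Bool) → (A → A) → ℕ → A → A
iterateWhile c step zero    s = s
iterateWhile c step (suc n) s = if c s then iterateWhile c step n (step s) else s

module _ {guard : A → Bool} {step : A → A}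
         (guardᴾ : PolyTime a codeBool guard)
         (body : Prog) (bodyTime : Poly)
         -- Only states that pass the guard have to be handled, so a body may take the head of a
         -- worklist for granted.
         (bodyRuns : ∀ s → guard s ≡ true → body ⊢ a s ⇓ a (step s) within bodyTime)
         (measure : A → ℕ)
         (decreasing : ∀ s → guard s ≡ true → measure (step s) < measure s)
         where

  private
    iter : ℕ → A → A
    iter = iterateWhile guard step

    iter-false : ∀ n s → guard s ≡ false → iter n s ≡ s
    iter-false zero    s e = refl
    iter-false (suc n) s e rewrite e = refl

    iter-true : ∀ n s → guard s ≡ true → iter (suc n) s ≡ iter n (step s)
    iter-true n s e rewrite e = refl

    K : ℕ → ℕ
    K M = suc (evalPoly (time guardᴾ) M + evalPoly bodyTime M)

    -- A pass costs at most `K M` while all states fit into `M`; `suc n` instead of `n` pays for the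
    -- last, failing evaluation of the guard.
    run : ∀ n M s → measure s ≤ n → (∀ k → size (a (iter k s)) ≤ M) →
          Σ[ t ∈ ℕ ] (while (program guardᴾ) body ⊢ a s ⇓[ t ] a (iter n s)) × t ≤ suc n * K M
    run n M s μ≤ bounded with guard s in e | runs guardᴾ s
    ... | false | t , r , t≤ rewrite iter-false n s e =
      _ , stop r , ≤-trans (s≤s (≤-trans (≤-trans t≤ (evalPoly-mono (time guardᴾ) (bounded 0))) (m≤m+n _ _))) (m≤m+n _ _)
    run zero    M s μ≤ bounded | true | t , r , t≤ = ⊥-elim (n≮0 (≤-trans (decreasing s e) μ≤))
    run (suc n) M s μ≤ bounded | true | t , r , t≤ =
      let s′ , r′ , s≤ = bodyRuns s e
          u , q , u≤ = run n M (step s) (s≤s⁻¹ (≤-trans (decreasing s e) μ≤))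
                         (λ k → subst (λ x → size (a x) ≤ M) (iter-true k s e) (bounded (suc k)))
      in _ , subst (λ x → while (program guardᴾ) body ⊢ a s ⇓[ suc (t + s′ + u) ] a x) (sym (iter-true n s e)) (loop r r′ q)
           , +-mono-≤ (s≤s (+-mono-≤ (≤-trans t≤ (evalPoly-mono (time guardᴾ) (bounded 0)))
                                     (≤-trans s≤ (evalPoly-mono bodyTime (bounded 0))))) u≤

  abstract
    -- A polynomial-time body could square the state on every pass. Hence a bound on all
    -- intermediate states is required in addition to one on the number of passes.
    whileᴾ : {init : B → A} → PolyTime b a init → (bound steps : Poly) →
             (∀ x k → size (a (iter k (init x))) ≤ evalPoly bound (size (b x))) →
             (∀ x → measure (init x) ≤ evalPoly steps (size (b x))) →
             PolyTime b a (λ x → iter (measure (init x)) (init x))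
    whileᴾ {init = init} I bound steps bounded few = polyTime (program I ⨾ while (program guardᴾ) body)
      (const 1 ⊕ (time I ⊕ (const 1 ⊕ steps) ⊗ (const 1 ⊕ (time guardᴾ ⟨ bound ⟩ ⊕ bodyTime ⟨ bound ⟩)))) λ x →
      let s , r , s≤ = runs I x
          t , q , t≤ = run (measure (init x)) _ (init x) ≤-refl (bounded x)
      in _ , seq r q , s≤s (+-mono-≤ s≤ (≤-trans t≤ (*-mono-≤ (s≤s (few x)) (≤-reflexive (cong suc (cong₂ _+_
           (sym (evalPoly-⟨⟩ (time guardᴾ) bound _)) (sym (evalPoly-⟨⟩ bodyTime bound _))))))))

module _ {U V : Set} {x : U → 𝔻} {y : V → 𝔻} {l : A → List U} {i : A → V} {h : A → U → V → V}
         (L : PolyTime a (codeList x) l) (I : PolyTime a y i)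
         (H : PolyTime (codeProduct a (codeProduct x y)) y (λ (γ , u , v) → h γ u v))
         (growth : Poly)
         -- The increase is bounded in terms of the context and the list alone; a bound that
         -- depended on the accumulator would admit exponential growth. Only accumulators that
         -- really occur are concerned.
         (grows : ∀ γ u us → size (y (h γ u (foldr (h γ) (i γ) us))) ≤
           size (y (foldr (h γ) (i γ) us)) + evalPoly growth (size (a γ) + size (codeList x (u ∷ us))))
         where

  private
    result : A → List U → V
    result γ us = foldr (h γ) (i γ) us

    -- The elements already processed are part of the state only to describe
    -- the intermediate result; they are not encoded.
    State : Set
    State = A × List U × List U

    codeState : State → 𝔻
    codeState (γ , us , vs) = a γ ∙ codeList x vs ∙ y (result γ us)

    guard : State → Bool
    guard (γ , us , [])    = false
    guard (γ , us , _ ∷ _) = true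

    step : State → State
    step s@(γ , us , [])   = s
    step (γ , us , v ∷ vs) = γ , v ∷ us , vs

    guardᴾ : PolyTime codeState codeBool guard
    guardᴾ = polyTime-cong (λ { (γ , us , []) → refl ; (γ , us , _ ∷ _) → refl })
      (branchᴾ (headᴾ (tailᴾ (toRaw idᴾ))) (constᴾ true) (constᴾ false))

    bodyᴾ : PolyTime (codeProduct a (codeProduct (codeProduct x (codeList x)) y))
                     (codeProduct a (codeProduct (codeList x) y))
                     (λ (γ , (u , us) , v) → γ , us , h γ u v)
    bodyᴾ = π₁ ,ᴾ (π₂ ⟫ π₁ ⟫ π₂) ,ᴾ ((π₁ ,ᴾ (π₂ ⟫ π₁ ⟫ π₁) ,ᴾ (π₂ ⟫ π₂)) ⟫ H)

    bodyRuns : ∀ s → guard s ≡ true → program bodyᴾ ⊢ codeState s ⇓ codeState (step s) within time bodyᴾ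
    bodyRuns (γ , us , v ∷ vs) _ = runs bodyᴾ (γ , (v , vs) , result γ us)

    todo : State → ℕ
    todo (_ , _ , vs) = length vs

    todo-decreasing : ∀ s → guard s ≡ true → todo (step s) < todo s
    todo-decreasing (γ , us , v ∷ vs) _ = ≤-refl

    initᴾ : PolyTime a codeState (λ γ → γ , [] , l γ)
    initᴾ = fromRaw (toRaw (idᴾ ,ᴾ L ,ᴾ I))

    iter : ℕ → State → State
    iter = iterateWhile guard step

    iter-finished : ∀ γ us vs → iter (length vs) (γ , us , vs) ≡ (γ , vs ʳ++ us , [])
    iter-finished γ us []       = refl
    iter-finished γ us (v ∷ vs) = iter-finished γ (v ∷ us) vs

    length≤size : ∀ us → length us ≤ size (codeList x us)
    length≤size []       = z≤n
    length≤size (u ∷ us) = s≤s (≤-trans (length≤size us) (m≤n+m _ (size (x u))))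

    result-size : ∀ γ us → size (y (result γ us)) ≤
      size (y (i γ)) + size (codeList x us) * evalPoly growth (size (a γ) + size (codeList x us))
    result-size γ []       = m≤m+n _ _
    result-size γ (u ∷ us) = begin
      size (y (result γ (u ∷ us)))          ≤⟨ grows γ u us ⟩
      size (y (result γ us)) + Q (u ∷ us)   ≤⟨ +-monoˡ-≤ _ (result-size γ us) ⟩
      size (y (i γ)) + n * Q us + Q (u ∷ us)
        ≤⟨ +-monoˡ-≤ _ (+-monoʳ-≤ (size (y (i γ))) (*-mono-≤ {n} n≤ (evalPoly-mono growth (+-monoʳ-≤ (size (a γ)) (≤-trans n≤ (n≤1+n _)))))) ⟩
      size (y (i γ)) + m * Q (u ∷ us) + Q (u ∷ us)
        ≡⟨ trans (+-assoc (size (y (i γ))) _ _) (cong (size (y (i γ)) +_) (+-comm (m * Q (u ∷ us)) _)) ⟩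
      size (y (i γ)) + suc m * Q (u ∷ us) ∎
      where
      open ≤-Reasoning
      Q : List U → ℕ
      Q ws = evalPoly growth (size (a γ) + size (codeList x ws))
      n m : ℕ
      n = size (codeList x us)
      m = size (x u) + n
      n≤ : n ≤ m
      n≤ = m≤n+m n (size (x u))

    -- A list split into a processed and a remaining part has one more `nil`, whence the `const 1`
    -- in `listSize`. The shape of `bound` follows `codeState`, its two constants counting the
    -- pairing nodes.
    listSize bound : Poly
    listSize = const 1 ⊕ outputSize L
    bound = const 1 ⊕ (X ⊕ (const 1 ⊕ (listSize ⊕ (outputSize I ⊕ listSize ⊗ growth ⟨ X ⊕ listSize ⟩))))

    Reachable : A → State → Set
    Reachable γ₀ (γ , us , vs) =
      γ ≡ γ₀ × size (codeList x us) + size (codeList x vs) ≡ suc (size (codeList x (l γ₀)))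

    step-reachable : ∀ γ₀ s → Reachable γ₀ s → Reachable γ₀ (step s)
    step-reachable γ₀ (γ , us , [])     r       = r
    step-reachable γ₀ (γ , us , v ∷ vs) (e , r) = e , trans (shift (size (x v)) (size (codeList x us)) _) r
      where
      shift : ∀ k m n → suc (k + m + n) ≡ m + suc (k + n)
      shift = ℕ-solver.solve-∀

    iter-reachable : ∀ γ₀ k s → Reachable γ₀ s → Reachable γ₀ (iter k s)
    iter-reachable γ₀ zero    s r = r
    iter-reachable γ₀ (suc k) s r with guard s
    ... | true  = iter-reachable γ₀ k (step s) (step-reachable γ₀ s r)
    ... | false = r

    reachable-size : ∀ γ₀ s → Reachable γ₀ s → size (codeState s) ≤ evalPoly bound (size (a γ₀))
    reachable-size γ (.γ , us , vs) (refl , e) =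
      s≤s (+-monoʳ-≤ (size (a γ)) (s≤s (+-mono-≤ (fits (m≤n+m _ _))
        (≤-trans (result-size γ us) (+-mono-≤ (size-output I γ)
          (*-mono-≤ {size (codeList x us)} (fits (m≤m+n _ _))
            (≤-trans (evalPoly-mono growth (+-monoʳ-≤ (size (a γ)) (fits (m≤m+n _ _))))
                     (≤-reflexive (sym (evalPoly-⟨⟩ growth (X ⊕ listSize) (size (a γ))))))))))))
      where
      fits : ∀ {k} → k ≤ size (codeList x us) + size (codeList x vs) → k ≤ evalPoly listSize (size (a γ))
      fits k≤ = ≤-trans k≤ (≤-trans (≤-reflexive e) (s≤s (size-output L γ)))

  abstract
    -- A loop consumes the list from the front, whereas `foldr` starts at the back: what it computes
    -- is the fold of the reversed list.
    foldr-reverseᴾ : PolyTime a y (λ γ → foldr (h γ) (i γ) (reverse (l γ)))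
    foldr-reverseᴾ = fromRaw (polyTime-cong {b = 𝔻-id} {f = λ γ → tail (tail (codeState (iter (length (l γ)) (γ , [] , l γ))))}
      (λ γ → cong (λ s → tail (tail (codeState s))) (iter-finished γ [] (l γ)))
      (tailᴾ (tailᴾ (toRaw (whileᴾ guardᴾ (program bodyᴾ) (time bodyᴾ) bodyRuns todo todo-decreasing initᴾ bound (outputSize L)
        (λ γ k → reachable-size γ _ (iter-reachable γ k (γ , [] , l γ) (refl , refl)))
        (λ γ → ≤-trans (length≤size (l γ)) (size-output L γ)))))))

-- List operations in polynomial time

size-∷ : ∀ (b : B → 𝔻) n u us vs →
         size (codeList b (u ∷ vs)) ≤ size (codeList b vs) + (n + size (codeList b (u ∷ us)))
size-∷ b n u us vs = begin
  suc (size (b u) + size (codeList b vs)) ≡⟨ cong suc (+-comm (size (b u)) _) ⟩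
  suc (size (codeList b vs) + size (b u)) ≡⟨ sym (+-suc _ _) ⟩
  size (codeList b vs) + suc (size (b u)) ≤⟨ +-monoʳ-≤ (size (codeList b vs)) (s≤s (m≤m+n (size (b u)) _)) ⟩
  size (codeList b vs) + size (codeList b (u ∷ us)) ≤⟨ +-monoʳ-≤ (size (codeList b vs)) (m≤n+m _ n) ⟩
  size (codeList b vs) + (n + size (codeList b (u ∷ us))) ∎
  where open ≤-Reasoning

abstract
  -- Folding with `_∷_` is the identity, so this instance of `foldr-reverseᴾ` is reversal itself. It
  -- is then used to remove the reversal from all other folds.
  reverseᴾ : {l : A → List B} → PolyTime a (codeList b) l → PolyTime a (codeList b) (λ γ → reverse (l γ))
  reverseᴾ {b = b} {l = l} L = polyTime-cong
    (λ γ → cong (codeList b) (sym (id-is-foldr (reverse (l γ)))))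
    (foldr-reverseᴾ {h = λ _ → _∷_} L (constᴾ []) (fromRaw (toRaw π₂)) X λ γ u us → size-∷ b _ u us _)

module _ {U V : Set} {x : U → 𝔻} {y : V → 𝔻} {l : A → List U} {i : A → V} {h : A → U → V → V} where

  abstract
    foldrᴾ : PolyTime a (codeList x) l → PolyTime a y i →
             PolyTime (codeProduct a (codeProduct x y)) y (λ (γ , u , v) → h γ u v) →
             (growth : Poly) →
             (∀ γ u us → let v = foldr (h γ) (i γ) us in
               size (y (h γ u v)) ≤ size (y v) + evalPoly growth (size (a γ) + size (codeList x (u ∷ us)))) →
             PolyTime a y (λ γ → foldr (h γ) (i γ) (l γ))
    foldrᴾ L I H growth grows = polyTime-cong
      (λ γ → cong (λ us → y (foldr (h γ) (i γ) us)) (reverse-involutive (l γ)))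
      (foldr-reverseᴾ (reverseᴾ L) I H growth grows)

abstract
  _++ᴾ_ : {f g : A → List B} → PolyTime a (codeList b) f → PolyTime a (codeList b) g →
          PolyTime a (codeList b) (λ γ → f γ ++ g γ)
  _++ᴾ_ {b = b} {f = f} {g} F G = polyTime-cong
    (λ γ → cong (codeList b) (sym (++-is-foldr (f γ) (g γ))))
    (foldrᴾ {h = λ _ → _∷_} F G (fromRaw (toRaw π₂)) X λ γ u us → size-∷ b _ u us _)

size-++ : ∀ (b : B → 𝔻) us vs → size (codeList b (us ++ vs)) ≤ size (codeList b us) + size (codeList b vs)
size-++ b []       vs = n≤1+n _
size-++ b (u ∷ us) vs = s≤s (≤-trans (+-monoʳ-≤ (size (b u)) (size-++ b us vs)) (≤-reflexive (sym (+-assoc (size (b u)) _ _))))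

abstract
  concatMapᴾ : {l : A → List B} {f : A → B → List C} → PolyTime a (codeList b) l →
               PolyTime (codeProduct a b) (codeList c) (λ (γ , u) → f γ u) →
               PolyTime a (codeList c) (λ γ → concatMap (f γ) (l γ))
  concatMapᴾ {a = a} {b = b} {c = c} {l = l} {f} L F = polyTime-cong
    (λ γ → cong (codeList c) (lemma (f γ) (l γ)))
    (foldrᴾ {h = λ γ u → f γ u ++_} L (constᴾ []) (((π₁ ,ᴾ (π₂ ⟫ π₁)) ⟫ F) ++ᴾ (π₂ ⟫ π₂)) (outputSize F) λ γ u us →
      let v = foldr (λ u → f γ u ++_) [] us in begin
      size (codeList c (f γ u ++ v)) ≤⟨ size-++ c (f γ u) v ⟩
      size (codeList c (f γ u)) + size (codeList c v) ≡⟨ +-comm (size (codeList c (f γ u))) _ ⟩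
      size (codeList c v) + size (codeList c (f γ u)) ≤⟨ +-monoʳ-≤ (size (codeList c v)) (≤-trans (size-output F (γ , u)) (evalPoly-mono (outputSize F) (argument γ u us))) ⟩
      size (codeList c v) + evalPoly (outputSize F) (size (a γ) + size (codeList b (u ∷ us))) ∎)
    where
    open ≤-Reasoning
    lemma : (f : B → List C) (us : List B) → foldr (λ u → f u ++_) [] us ≡ concatMap f us
    lemma f []       = refl
    lemma f (u ∷ us) = cong (f u ++_) (lemma f us)
    argument : ∀ γ u us → suc (size (a γ) + size (b u)) ≤ size (a γ) + size (codeList b (u ∷ us))
    argument γ u us = ≤-trans (≤-reflexive (sym (+-suc _ _))) (+-monoʳ-≤ (size (a γ)) (s≤s (m≤m+n (size (b u)) _)))

  concatᴾ : {l : A → List (List B)} → PolyTime a (codeList (codeList b)) l →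
            PolyTime a (codeList b) (λ γ → concat (l γ))
  concatᴾ {b = b} {l = l} L = polyTime-cong (λ γ → cong (λ us → codeList b (concat us)) (map-id (l γ)))
    (concatMapᴾ {f = λ _ us → us} L π₂)

  [_]ᴾ : {f : A → B} → PolyTime a b f → PolyTime a (codeList b) (λ γ → f γ ∷ [])
  [ F ]ᴾ = fromRaw (raw,ᴾ (toRaw F) (constᴰ nil))

  mapᴾ : {l : A → List B} {f : A → B → C} → PolyTime a (codeList b) l →
         PolyTime (codeProduct a b) c (λ (γ , u) → f γ u) →
         PolyTime a (codeList c) (λ γ → map (f γ) (l γ))
  mapᴾ {c = c} {l = l} {f} L F = polyTime-cong
    (λ γ → cong (codeList c) (trans (sym (concatMap-map (_∷ []) (f γ) (l γ))) (concatMap-pure (map (f γ) (l γ)))))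
    (concatMapᴾ {f = λ γ u → f γ u ∷ []} L [ F ]ᴾ)

  take₁ᴾ : {l : A → List B} → PolyTime a (codeList b) l → PolyTime a (codeList b) (λ γ → take 1 (l γ))
  take₁ᴾ {b = b} {l = l} L = fromRaw (polyTime-cong {b = 𝔻-id} (λ γ → lemma (l γ))
    (branchᴾ (toRaw L) (raw,ᴾ (headᴾ (toRaw L)) (constᴰ nil)) (constᴰ nil)))
    where
    lemma : ∀ us → branch (codeList b us) (head (codeList b us) ∙ nil) nil ≡ codeList b (take 1 us)
    lemma []       = refl
    lemma (u ∷ us) = refl

when : Bool → List A → List A
when t us = if t then us else []

abstract
  whenᴾ : {t : A → Bool} {l : A → List B} → PolyTime a codeBool t → PolyTime a (codeList b) l →
          PolyTime a (codeList b) (λ γ → when (t γ) (l γ))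
  whenᴾ T L = ifᴾ T L (constᴾ [])

module _ (_≟_ : DecidableEquality B)
         (≟ᴾ : PolyTime (codeProduct b b) codeBool (λ (u , v) → does (u ≟ v))) where

  open DecPropositional _≟_ using (_∈?_)

  abstract
    ∈?ᴾ : {f : A → B} {l : A → List B} → PolyTime a b f → PolyTime a (codeList b) l →
          PolyTime a codeBool (λ γ → does (f γ ∈? l γ))
    ∈?ᴾ {f = f} {l} F L = polyTime-cong (λ γ → cong codeBool (lemma (f γ) (l γ)))
      (foldrᴾ {h = λ γ u v → does (f γ ≟ u) ∨ v} L (constᴾ false)
        (∨ᴾ (((π₁ ⟫ F) ,ᴾ (π₂ ⟫ π₁)) ⟫ ≟ᴾ) (π₂ ⟫ π₂)) (const 3)
        λ γ u us → ≤-trans (bool-size _) (m≤n+m 3 (size (codeBool _))))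
      where
      lemma : ∀ u us → foldr (λ w v → does (u ≟ w) ∨ v) false us ≡ does (u ∈? us)
      lemma u []       = refl
      lemma u (w ∷ us) = cong (does (u ≟ w) ∨_) (lemma u us)
      bool-size : ∀ t → size (codeBool t) ≤ 3
      bool-size true  = ≤-refl
      bool-size false = s≤s z≤n

∈-when⁺ : {P : Set} (P? : Dec P) → P → {x : A} {us : List A} → x ∈ us → x ∈ when (does P?) us
∈-when⁺ (yes _) p x∈ = x∈
∈-when⁺ (no ¬p) p x∈ = ⊥-elim (¬p p)

∈-when⁻ : {P : Set} (P? : Dec P) {x : A} {us : List A} → x ∈ when (does P?) us → P × x ∈ us
∈-when⁻ (yes p) x∈ = p , x∈

concatMap-∈⁺ : {f : A → List B} (us : List A) {x : A} {y : B} → x ∈ us → y ∈ f x → y ∈ concatMap f us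
concatMap-∈⁺ {f = f} us x∈ y∈ = ∈-concatMap⁺ f (lose x∈ y∈)

concatMap-∈⁻ : {f : A → List B} (us : List A) {y : B} → y ∈ concatMap f us → ∃[ x ] x ∈ us × y ∈ f x
concatMap-∈⁻ {f = f} us y∈ = find (∈-concatMap⁻ f y∈)

codeList-injective : {b : B → 𝔻} → (∀ u v → b u ≡ b v → u ≡ v) →
                     ∀ us vs → codeList b us ≡ codeList b vs → us ≡ vs
codeList-injective inj []       []       _ = refl
codeList-injective inj (u ∷ us) (v ∷ vs) e =
  cong₂ _∷_ (inj u v (cong head e)) (codeList-injective inj us vs (cong tail e))

-- The saturation algorithm

module Construction (S : Signature) (𝒟 : ConcreteDomain) where

  open Signature S
  open ConcreteDomain 𝒟 hiding (Δ)
  open Logic S 𝒟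
  open Axiom

  -- Comparing and taking apart concepts through their codes

  codeAtom-injective : ∀ α β → codeAtom α ≡ codeAtom β → α ≡ β
  codeAtom-injective (P · us) (Q · vs) e with pred-injective (cong head e)
  ... | refl = cong (P ·_) (trans (sym (cast-is-id refl us))
                 (toList-injective refl us vs (codeList-injective (λ _ _ → var-injective) _ _ (cong tail e))))

  codeELD-injective : ∀ C D → codeELD C ≡ codeELD D → C ≡ D
  codeELD-injective ⊤ ⊤ e = refl
  codeELD-injective ⊥ ⊥ e = refl
  codeELD-injective (name A) (name B) e = cong name (conceptName-injective (cong tail e))
  codeELD-injective [ α ] [ β ] e = cong [_] (codeAtom-injective α β (cong tail e))
  codeELD-injective (C ⊓ D) (C′ ⊓ D′) e =
    cong₂ _⊓_ (codeELD-injective C C′ (cong (λ t → head (tail t)) e))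
              (codeELD-injective D D′ (cong (λ t → tail (tail t)) e))
  codeELD-injective (some r C) (some s D) e =
    cong₂ some (roleName-injective (cong (λ t → head (tail t)) e))
               (codeELD-injective C D (cong (λ t → tail (tail t)) e))

  codeELDAxiom-injective : ∀ η θ → codeELDAxiom η ≡ codeELDAxiom θ → η ≡ θ
  codeELDAxiom-injective η θ e =
    cong₂ _⊑_ (codeELD-injective _ _ (cong head e)) (codeELD-injective _ _ (cong tail e))

  abstract
    -- Names come without a decision procedure for equality; injectivity of their codes transfers
    -- the one for trees. The resulting Boolean is then literally the comparison made by `eq`.
    _≟ᶜ_ : DecidableEquality ELD
    C ≟ᶜ D = map′ (codeELD-injective C D) (cong codeELD) (codeELD C ≟ᴰ codeELD D)

    _≟_ : DecidableEquality ELDAxiom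
    η ≟ θ = map′ (codeELDAxiom-injective η θ) (cong codeELDAxiom) (codeELDAxiom η ≟ᴰ codeELDAxiom θ)

    ≟ᶜᴾ : {f g : A → ELD} → PolyTime a codeELD f → PolyTime a codeELD g →
          PolyTime a codeBool (λ γ → does (f γ ≟ᶜ g γ))
    ≟ᶜᴾ F G = eqᴾ (toRaw F) (toRaw G)

    ≟ᴾ : {f g : A → ELDAxiom} → PolyTime a codeELDAxiom f → PolyTime a codeELDAxiom g →
         PolyTime a codeBool (λ γ → does (f γ ≟ g γ))
    ≟ᴾ F G = eqᴾ (toRaw F) (toRaw G)

  open DecPropositional _≟_ using (_∈?_)

  codeAxioms : List ELDAxiom → 𝔻
  codeAxioms = codeList codeELDAxiom

  codeSteps : List (List ELDAxiom) → 𝔻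
  codeSteps = codeList codeAxioms

  infix 4 _∈ᴾ_

  _∈ᴾ_ : {f : A → ELDAxiom} {l : A → List ELDAxiom} → PolyTime a codeELDAxiom f → PolyTime a codeAxioms l →
         PolyTime a codeBool (λ γ → does (f γ ∈? l γ))
  _∈ᴾ_ = ∈?ᴾ _≟_ (≟ᴾ π₁ π₂)

  lhsᴾ : {f : A → ELDAxiom} → PolyTime a codeELDAxiom f → PolyTime a codeELD (λ γ → lhs (f γ))
  lhsᴾ F = fromRaw (headᴾ (toRaw F))

  rhsᴾ : {f : A → ELDAxiom} → PolyTime a codeELDAxiom f → PolyTime a codeELD (λ γ → rhs (f γ))
  rhsᴾ F = fromRaw (tailᴾ (toRaw F))

  infix 4 _⊑ᴾ_

  _⊑ᴾ_ : {f g : A → ELD} → PolyTime a codeELD f → PolyTime a codeELD g →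
         PolyTime a codeELDAxiom (λ γ → f γ ⊑ g γ)
  F ⊑ᴾ G = fromRaw (toRaw (F ,ᴾ G))

  infixr 6 _⊓ᴾ_

  _⊓ᴾ_ : {f g : A → ELD} → PolyTime a codeELD f → PolyTime a codeELD g →
         PolyTime a codeELD (λ γ → f γ ⊓ g γ)
  F ⊓ᴾ G = fromRaw (raw,ᴾ (constᴰ (codeℕ 4)) (toRaw (F ,ᴾ G)))

  someᴾ : {r : A → RoleName} {f : A → ELD} → PolyTime a codeRoleName r → PolyTime a codeELD f →
          PolyTime a codeELD (λ γ → some (r γ) (f γ))
  someᴾ R F = fromRaw (raw,ᴾ (constᴰ (codeℕ 5)) (toRaw (R ,ᴾ F)))

  conceptᴾ : PolyTime codeConstraint codeELD concept
  conceptᴾ = fromRaw (polyTime-cong {b = 𝔻-id} (λ { ⊥ᵖ → refl ; (atom α) → refl })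
    (branchᴾ (toRaw idᴾ) (raw,ᴾ (constᴰ (codeℕ 3)) (tailᴾ (toRaw idᴾ))) (constᴰ (codeELD ⊥))))

  -- These destructors return the empty list on concepts of another shape, so that `map` and
  -- `concatMap` do the case distinctions inside polynomial-time functions.
  conjuncts : ELD → List ELD
  conjuncts (C ⊓ D) = C ∷ D ∷ []
  conjuncts _       = []

  successors : ELD → List (RoleName × ELD)
  successors (some r C) = (r , C) ∷ []
  successors _          = []

  asConstraint : ELD → List Constraint
  asConstraint ⊥     = ⊥ᵖ ∷ []
  asConstraint [ α ] = atom α ∷ []
  asConstraint _     = []

  private
    tagged : ∀ k → PolyTime codeELD codeBool (λ C → does (head (codeELD C) ≟ᴰ codeℕ k))
    tagged k = eqᴾ (headᴾ (toRaw idᴾ)) (constᴰ (codeℕ k))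

    argument : PolyTime codeELD 𝔻-id (λ C → tail (codeELD C))
    argument = tailᴾ (toRaw idᴾ)

  conjunctsᴾ : PolyTime codeELD (codeList codeELD) conjuncts
  conjunctsᴾ = fromRaw (polyTime-cong {b = 𝔻-id}
    (λ { ⊤ → refl ; ⊥ → refl ; (name _) → refl ; [ _ ] → refl ; (_ ⊓ _) → refl ; (some _ _) → refl })
    (ifᴾ (tagged 4) (raw,ᴾ (headᴾ argument) (raw,ᴾ (tailᴾ argument) (constᴰ nil))) (constᴰ nil)))

  successorsᴾ : PolyTime codeELD (codeList (codeProduct codeRoleName codeELD)) successors
  successorsᴾ = fromRaw (polyTime-cong {b = 𝔻-id}
    (λ { ⊤ → refl ; ⊥ → refl ; (name _) → refl ; [ _ ] → refl ; (_ ⊓ _) → refl ; (some _ _) → refl })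
    (ifᴾ (tagged 5) (raw,ᴾ argument (constᴰ nil)) (constᴰ nil)))

  asConstraintᴾ : PolyTime codeELD (codeList codeConstraint) asConstraint
  asConstraintᴾ = fromRaw (polyTime-cong {b = 𝔻-id}
    (λ { ⊤ → refl ; ⊥ → refl ; (name _) → refl ; [ _ ] → refl ; (_ ⊓ _) → refl ; (some _ _) → refl })
    (ifᴾ (tagged 3) (raw,ᴾ (raw,ᴾ (constᴰ nil) argument) (constᴰ nil))
      -- `nil ∙ nil` is the code of the list `⊥ᵖ ∷ []`.
      (ifᴾ (tagged 1) (constᴰ (nil ∙ nil)) (constᴰ nil))))

  -- Closure under subconcepts

  children : ELD → List ELD
  children C = conjuncts C ++ map proj₂ (successors C)

  childrenᴾ : PolyTime codeELD (codeList codeELD) children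
  childrenᴾ = conjunctsᴾ ++ᴾ mapᴾ successorsᴾ (π₂ ⟫ π₂)

  codeConcepts : List ELD → 𝔻
  codeConcepts = codeList codeELD

  -- Structural recursion branches at `⊓`; with a list of concepts still to be visited it becomes a
  -- single loop.
  Search : Set
  Search = List ELD × List ELD

  pending : Search → Bool
  pending ([]    , _) = false
  pending (_ ∷ _ , _) = true

  visit : Search → Search
  visit ([]     , found) = [] , found
  visit (C ∷ Cs , found) = children C ++ Cs , C ∷ found

  workSize : Search → ℕ
  workSize (Cs , _) = size (codeConcepts Cs)

  search : ℕ → Search → Search
  search = iterateWhile pending visit

  subconcepts : List ELD → List ELD
  subconcepts Cs = proj₂ (search (size (codeConcepts Cs)) (Cs , []))

  -- The constructor tag that a visit strips off is larger than the list nodes gained for the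
  -- children. Without its arguments a conjunction has size 11, of which 9 is the tag `codeℕ 4`; an
  -- existential restriction has size 13, of which 11 is `codeℕ 5`.
  visit-decreasing : ∀ s → pending s ≡ true → workSize (visit s) < workSize s
  visit-decreasing (C ∷ Cs , _) _ = s≤s (smaller C (size (codeConcepts Cs)) Cs ≤-refl)
    where
    smaller : ∀ C n Cs → size (codeConcepts Cs) ≤ n → size (codeConcepts (children C ++ Cs)) ≤ size (codeELD C) + n
    smaller ⊤          n Cs le = ≤-trans le (m≤n+m n _)
    smaller ⊥          n Cs le = ≤-trans le (m≤n+m n _)
    smaller (name A)   n Cs le = ≤-trans le (m≤n+m n _)
    smaller [ α ]      n Cs le = ≤-trans le (m≤n+m n _)
    smaller (C ⊓ D)    n Cs le = begin
      suc (size (codeELD C) + suc (size (codeELD D) + size (codeConcepts Cs)))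
        ≤⟨ s≤s (+-monoʳ-≤ (size (codeELD C)) (s≤s (+-monoʳ-≤ (size (codeELD D)) le))) ⟩
      suc (size (codeELD C) + suc (size (codeELD D) + n)) ≡⟨ rearrange (size (codeELD C)) _ n ⟩
      2 + (size (codeELD C) + size (codeELD D)) + n ≤⟨ +-monoˡ-≤ n (+-monoˡ-≤ (size (codeELD C) + size (codeELD D)) (m≤m+n 2 9)) ⟩
      11 + (size (codeELD C) + size (codeELD D)) + n ∎
      where
      open ≤-Reasoning
      rearrange : ∀ k m n → suc (k + suc (m + n)) ≡ 2 + (k + m) + n
      rearrange = ℕ-solver.solve-∀
    smaller (some r C) n Cs le = begin
      suc (size (codeELD C) + size (codeConcepts Cs)) ≤⟨ +-mono-≤ {1 + size (codeELD C)} (+-mono-≤ {1} {13 + size (codeRoleName r)} (s≤s z≤n) ≤-refl) le ⟩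
      13 + size (codeRoleName r) + size (codeELD C) + n ∎
      where open ≤-Reasoning

  private
    codeSearch : Search → 𝔻
    codeSearch = codeProduct codeConcepts codeConcepts

    pendingᴾ : PolyTime codeSearch codeBool pending
    pendingᴾ = polyTime-cong (λ { ([] , _) → refl ; (_ ∷ _ , _) → refl })
      (branchᴾ (headᴾ (toRaw idᴾ)) (constᴾ true) (constᴾ false))

    visitᴾ : PolyTime (codeProduct (codeProduct codeELD codeConcepts) codeConcepts) codeSearch
                      (λ ((C , Cs) , found) → children C ++ Cs , C ∷ found)
    visitᴾ = (((π₁ ⟫ π₁ ⟫ childrenᴾ) ++ᴾ (π₁ ⟫ π₂)) ,ᴾ ([ π₁ ⟫ π₁ ]ᴾ ++ᴾ π₂))

    visitRuns : ∀ s → pending s ≡ true → program visitᴾ ⊢ codeSearch s ⇓ codeSearch (visit s) within time visitᴾ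
    visitRuns (C ∷ Cs , found) _ = runs visitᴾ ((C , Cs) , found)

    -- A potential: a visit adds at most `W` to the found list and lowers the remaining work,
    -- weighted by `W`, by at least one unit. At the start the found list is `[]` of size 1 and the
    -- work is at most `W`.
    Bounded : ℕ → Search → Set
    Bounded W (Cs , found) =
      size (codeConcepts Cs) ≤ W × size (codeConcepts found) + size (codeConcepts Cs) * W ≤ 1 + W * W

    visit-bounded : ∀ W s → Bounded W s → Bounded W (visit s)
    visit-bounded W ([] , found)     bnd     = bnd
    visit-bounded W s@(C ∷ Cs , found) (p , q) =
      ≤-trans (≤-trans (n≤1+n _) (visit-decreasing s refl)) p , (begin
      suc (size (codeELD C) + size (codeConcepts found)) + w * W
        ≤⟨ +-monoˡ-≤ (w * W) (+-monoˡ-≤ (size (codeConcepts found)) (≤-trans (s≤s (m≤m+n (size (codeELD C)) _)) p)) ⟩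
      W + size (codeConcepts found) + w * W ≡⟨ trans (cong (_+ w * W) (+-comm W _)) (+-assoc (size (codeConcepts found)) W (w * W)) ⟩
      size (codeConcepts found) + suc w * W ≤⟨ +-monoʳ-≤ (size (codeConcepts found)) (*-mono-≤ (visit-decreasing s refl) ≤-refl) ⟩
      size (codeConcepts found) + workSize s * W ≤⟨ q ⟩
      1 + W * W ∎)
      where
      open ≤-Reasoning
      w = size (codeConcepts (children C ++ Cs))

    search-preserves : ∀ {P : Search → Set} → (∀ s → P s → P (visit s)) → ∀ n s → P s → P (search n s)
    search-preserves inv zero    s p = p
    search-preserves inv (suc n) s p with pending s
    ... | true  = search-preserves inv n (visit s) (inv s p)
    ... | false = p

    search-finished : ∀ n s → workSize s ≤ n → proj₁ (search n s) ≡ []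
    search-finished zero    (Cs , _)       le = ⊥-elim (n≮0 (≤-trans (size≥1 (codeConcepts Cs)) le))
    search-finished (suc n) ([] , _)       le = refl
    search-finished (suc n) s@(C ∷ Cs , _) le =
      search-finished n (visit s) (s≤s⁻¹ (≤-trans (visit-decreasing s refl) le))

    Closing : List ELD → Search → Set
    Closing Cs (todo , found) =
      (∀ {C} → C ∈ Cs → C ∈ todo ⊎ C ∈ found) ×
      (∀ {C D} → C ∈ found → D ∈ children C → D ∈ todo ⊎ D ∈ found)

    visit-closing : ∀ Cs s → Closing Cs s → Closing Cs (visit s)
    visit-closing Cs ([] , found)       inv     = inv
    visit-closing Cs (C ∷ todo , found) (p , q) = (λ D∈ → move (p D∈)) ,
      (λ { (here refl) D∈ → inj₁ (∈-++⁺ˡ D∈) ; (there E∈) D∈ → move (q E∈ D∈) })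
      where
      move : ∀ {D} → D ∈ C ∷ todo ⊎ D ∈ found → D ∈ children C ++ todo ⊎ D ∈ C ∷ found
      move (inj₁ (here refl)) = inj₂ (here refl)
      move (inj₁ (there D∈))  = inj₁ (∈-++⁺ʳ (children C) D∈)
      move (inj₂ D∈)          = inj₂ (there D∈)

    closing : ∀ Cs → Closing Cs ([] , subconcepts Cs)
    closing Cs = subst (λ todo → Closing Cs (todo , subconcepts Cs)) (search-finished n (Cs , []) ≤-refl)
      (search-preserves {Closing Cs} (visit-closing Cs) n (Cs , []) (inj₁ , λ ()))
      where n = size (codeConcepts Cs)

  subconceptsᴾ : {l : A → List ELD} → PolyTime a codeConcepts l → PolyTime a codeConcepts (λ γ → subconcepts (l γ))
  subconceptsᴾ {l = l} L = whileᴾ pendingᴾ (program visitᴾ) (time visitᴾ) visitRuns workSize visit-decreasing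
    (L ,ᴾ constᴾ []) (const 1 ⊕ (outputSize L ⊕ (const 1 ⊕ outputSize L ⊗ outputSize L))) (outputSize L)
    (λ γ k → state-size γ (search k (l γ , [])) (search-preserves (visit-bounded _) k (l γ , []) (size-output L γ ,
      s≤s (*-mono-≤ (size-output L γ) ≤-refl)))) (size-output L) ⟫ π₂
    where
    state-size : ∀ γ s → Bounded (evalPoly (outputSize L) _) s → size (codeSearch s) ≤ _
    state-size γ s (p , q) = s≤s (+-mono-≤ p (≤-trans (m≤m+n _ _) q))

  ⊆-subconcepts : ∀ Cs {C} → C ∈ Cs → C ∈ subconcepts Cs
  ⊆-subconcepts Cs C∈ with proj₁ (closing Cs) C∈
  ... | inj₂ C∈′ = C∈′

  children-subconcepts : ∀ Cs {C D} → C ∈ subconcepts Cs → D ∈ children C → D ∈ subconcepts Cs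
  children-subconcepts Cs C∈ D∈ with proj₂ (closing Cs) C∈ D∈
  ... | inj₂ D∈′ = D∈′

  -- Inferences available from a list of known axioms

  module WithOracle (padm : PAdmissible) where

    valid? : (δs : List Constraint × List Constraint) → Dec (⊨ proj₁ δs ⇒ proj₂ δs)
    valid? δs with proj₂ (proj₂ (PAdmissible.validity padm)) δs
    ... | inj₁ (v , _)  = yes v
    ... | inj₂ (¬v , _) = no ¬v

    valid?ᴾ : PolyTime (codeProduct (codeList codeConstraint) (codeList codeConstraint)) codeBool (λ δs → does (valid? δs))
    valid?ᴾ = polyTime (proj₁ (PAdmissible.validity padm)) (proj₁ (proj₂ (PAdmissible.validity padm))) go
      where
      go : ∀ δs → proj₁ (PAdmissible.validity padm) ⊢ codeProduct (codeList codeConstraint) (codeList codeConstraint) δs ⇓ codeBool (does (valid? δs)) within proj₁ (proj₂ (PAdmissible.validity padm))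
      go δs with proj₂ (proj₂ (PAdmissible.validity padm)) δs
      ... | inj₁ (_ , r) = r
      ... | inj₂ (_ , r) = r

    -- The rule `R⊓⁻` for two conjuncts. Longer conjunctions are nested to the right, so it reaches
    -- their members by repetition.
    conclusions₁ : ELDAxiom → List ELDAxiom
    conclusions₁ η = map (lhs η ⊑_) (conjuncts (rhs η))

    -- The summands are `R⊑`, `R⊓⁺`, and `R∃` together with `R⊥`.
    conclusions₂ : ELDOntology → ELDAxiom → ELDAxiom → List ELDAxiom
    conclusions₂ O η θ =
      when (does ((rhs η ≟ᶜ lhs θ) ×-dec (θ ∈? O))) ((lhs η ⊑ rhs θ) ∷ []) ++
      when (does (lhs η ≟ᶜ lhs θ)) ((lhs η ⊑ rhs η ⊓ rhs θ) ∷ []) ++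
      concatMap (λ (r , C) → when (does (C ≟ᶜ lhs θ))
                   ((lhs η ⊑ some r (rhs θ)) ∷ when (does (rhs θ ≟ᶜ ⊥)) ((lhs η ⊑ ⊥) ∷ [])))
                (successors (rhs η))

    knownConstraints : List ELDAxiom → ELD → List Constraint
    knownConstraints Z C = concatMap (λ η → when (does (lhs η ≟ᶜ C)) (asConstraint (rhs η))) Z

    -- The conclusion is fixed in advance and tested against the rules, so `R⊓⁺` and `R∃` cannot
    -- generate concepts beyond the candidates.
    premiseSteps : ELDOntology → List ELDAxiom → ELDAxiom → List (List ELDAxiom)
    premiseSteps O Z η =
      concatMap (λ θ₁ → when (does (η ∈? conclusions₁ θ₁)) ((θ₁ ∷ []) ∷ []) ++
                        concatMap (λ θ₂ → when (does (η ∈? conclusions₂ O θ₁ θ₂)) ((θ₁ ∷ θ₂ ∷ []) ∷ [])) Z) Z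

    steps : ELDOntology → List ELDAxiom → ELDAxiom → List (List ELDAxiom)
    steps O Z η =
      when (does (rhs η ≟ᶜ lhs η)) ([] ∷ []) ++
      when (does (rhs η ≟ᶜ ⊤)) ([] ∷ []) ++
      -- All constraints known for the context serve as premises at once; any valid inference from
      -- some of them stays valid.
      concatMap (λ δ → when (does (valid? (knownConstraints Z (lhs η) , δ ∷ [])))
                   (map (λ γ → lhs η ⊑ concept γ) (knownConstraints Z (lhs η)) ∷ []))
                (asConstraint (rhs η)) ++
      premiseSteps O Z η

    -- A source of η is the list of its justifications in a proof: no step if η
    -- is a leaf, and one step otherwise.
    sources : ELDOntology → List ELDAxiom → ELDAxiom → List (List (List ELDAxiom))
    sources O Z η = when (does (η ∈? O)) ([] ∷ []) ++ map (_∷ []) (steps O Z η)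

    conclusions₁ᴾ : {f : A → ELDAxiom} → PolyTime a codeELDAxiom f →
                    PolyTime a codeAxioms (λ γ → conclusions₁ (f γ))
    conclusions₁ᴾ F = mapᴾ (rhsᴾ F ⟫ conjunctsᴾ) (lhsᴾ (π₁ ⟫ F) ⊑ᴾ π₂)

    conclusions₂ᴾ : {o : A → ELDOntology} {f g : A → ELDAxiom} → PolyTime a codeAxioms o →
                    PolyTime a codeELDAxiom f → PolyTime a codeELDAxiom g →
                    PolyTime a codeAxioms (λ γ → conclusions₂ (o γ) (f γ) (g γ))
    conclusions₂ᴾ O F G =
      whenᴾ (∧ᴾ (≟ᶜᴾ (rhsᴾ F) (lhsᴾ G)) (G ∈ᴾ O)) [ lhsᴾ F ⊑ᴾ rhsᴾ G ]ᴾ ++ᴾ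
      (whenᴾ (≟ᶜᴾ (lhsᴾ F) (lhsᴾ G)) [ lhsᴾ F ⊑ᴾ rhsᴾ F ⊓ᴾ rhsᴾ G ]ᴾ ++ᴾ
      concatMapᴾ (rhsᴾ F ⟫ successorsᴾ)
        (whenᴾ (≟ᶜᴾ (π₂ ⟫ π₂) (lhsᴾ (π₁ ⟫ G)))
          ([ lhsᴾ (π₁ ⟫ F) ⊑ᴾ someᴾ (π₂ ⟫ π₁) (rhsᴾ (π₁ ⟫ G)) ]ᴾ ++ᴾ
           whenᴾ (≟ᶜᴾ (rhsᴾ (π₁ ⟫ G)) (constᴾ ⊥)) [ lhsᴾ (π₁ ⟫ F) ⊑ᴾ constᴾ ⊥ ]ᴾ)))

    knownConstraintsᴾ : {z : A → List ELDAxiom} {f : A → ELD} → PolyTime a codeAxioms z → PolyTime a codeELD f →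
                        PolyTime a (codeList codeConstraint) (λ γ → knownConstraints (z γ) (f γ))
    knownConstraintsᴾ Z F = concatMapᴾ Z (whenᴾ (≟ᶜᴾ (lhsᴾ π₂) (π₁ ⟫ F)) (rhsᴾ π₂ ⟫ asConstraintᴾ))

    stepsᴾ : {o : A → ELDOntology} {z : A → List ELDAxiom} {f : A → ELDAxiom} →
             PolyTime a codeAxioms o → PolyTime a codeAxioms z → PolyTime a codeELDAxiom f →
             PolyTime a codeSteps (λ γ → steps (o γ) (z γ) (f γ))
    stepsᴾ O Z F =
      whenᴾ (≟ᶜᴾ (rhsᴾ F) (lhsᴾ F)) (constᴾ _) ++ᴾ
      (whenᴾ (≟ᶜᴾ (rhsᴾ F) (constᴾ ⊤)) (constᴾ _) ++ᴾ
      (concatMapᴾ (rhsᴾ F ⟫ asConstraintᴾ)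
        (whenᴾ ((knownConstraintsᴾ (π₁ ⟫ Z) (lhsᴾ (π₁ ⟫ F)) ,ᴾ [ π₂ ]ᴾ) ⟫ valid?ᴾ)
          [ mapᴾ (knownConstraintsᴾ (π₁ ⟫ Z) (lhsᴾ (π₁ ⟫ F)))
                 (lhsᴾ (π₁ ⟫ π₁ ⟫ F) ⊑ᴾ (π₂ ⟫ conceptᴾ)) ]ᴾ) ++ᴾ
      concatMapᴾ Z
        (whenᴾ ((π₁ ⟫ F) ∈ᴾ conclusions₁ᴾ π₂) [ [ π₂ ]ᴾ ]ᴾ ++ᴾ
         concatMapᴾ (π₁ ⟫ Z)
           (whenᴾ ((π₁ ⟫ π₁ ⟫ F) ∈ᴾ conclusions₂ᴾ (π₁ ⟫ π₁ ⟫ O) (π₁ ⟫ π₂) π₂)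
             [ [ π₁ ⟫ π₂ ]ᴾ ++ᴾ [ π₂ ]ᴾ ]ᴾ))))

    sourcesᴾ : {o : A → ELDOntology} {z : A → List ELDAxiom} {f : A → ELDAxiom} →
               PolyTime a codeAxioms o → PolyTime a codeAxioms z → PolyTime a codeELDAxiom f →
               PolyTime a (codeList codeSteps) (λ γ → sources (o γ) (z γ) (f γ))
    sourcesᴾ O Z F = whenᴾ (F ∈ᴾ O) (constᴾ _) ++ᴾ mapᴾ (stepsᴾ O Z F) [ π₂ ]ᴾ

    -- Saturation, justification and pruning as functions on lists

    addIfDerivable : ELDOntology → ELDAxiom → List ELDAxiom → List ELDAxiom
    addIfDerivable O η Z =
      -- A list cut to length at most one acts as an option: `η` is added once if it has any source.
      if does (η ∈? Z) then Z else map (λ _ → η) (take 1 (sources O Z η)) ++ Z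

    round : ELDOntology → List ELDAxiom → List ELDAxiom → List ELDAxiom
    round O K Z = foldr (addIfDerivable O) Z K

    -- Only the length of the list of ticks matters: it is the number of rounds.
    saturate : ELDOntology → List ELDAxiom → List ELDAxiom → List ELDAxiom
    saturate O K ticks = foldr (λ _ → round O K) [] ticks

    Line : Set
    Line = ELDAxiom × List (List ELDAxiom)

    codeLine : Line → 𝔻
    codeLine = codeProduct codeELDAxiom codeSteps

    newLine : ELDOntology → ELDAxiom → List ELDAxiom → List Line
    newLine O η Z = take 1 (map (η ,_) (sources O Z η))

    -- The saturation keeps only axioms, newest first. Justifications are recovered afterwards by
    -- searching for a source among the axioms further down the list, which were found earlier.
    lines : ELDOntology → List ELDAxiom → List Line
    lines O Z = foldr (λ η ls → newLine O η (map proj₁ ls) ++ ls) [] Z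

    Pruned : Set
    Pruned = List ELDAxiom × List Line

    codePruned : Pruned → 𝔻
    codePruned = codeProduct codeAxioms (codeList codeLine)

    keepIfNeeded : Line → Pruned → Pruned
    keepIfNeeded l (needed , kept) =
      if does (proj₁ l ∈? needed) then (concat (proj₂ l) ++ needed , l ∷ kept) else (needed , kept)

    -- Lines are listed in reverse order: a line precedes its premises.
    prune : ELDAxiom → List Line → List Line
    prune η ls = reverse (proj₂ (foldr keepIfNeeded (η ∷ [] , []) (reverse ls)))

    indexOf : ELDAxiom → List ELDAxiom → ℕ
    indexOf η θs = foldr (λ θ n → if does (η ≟ θ) then 0 else suc n) 0 θs

    codeEdges : List (List Bool × ℕ) → 𝔻
    codeEdges = codeList (codeProduct (codeList codeBool) codeℕ)

    -- Hyperedges in the form in which they appear in the code of a hypergraph: a list of Booleans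
    -- and a number in place of a `Subset` and a `Fin`, whose types depend on the number of lines.
    edgesOf : List Line → List (List Bool × ℕ)
    edgesOf ls = concatMap (λ l → map (λ ps → map (λ η → does (η ∈? ps)) (map proj₁ ls)
                                            , indexOf (proj₁ l) (map proj₁ ls)) (proj₂ l)) ls

    -- Size bounds and running times of these functions

    addIfDerivable-size : ∀ O η Z → size (codeAxioms (addIfDerivable O η Z)) ≤ size (codeAxioms Z) + suc (size (codeELDAxiom η))
    addIfDerivable-size O η Z with does (η ∈? Z) | sources O Z η
    ... | true  | _     = m≤m+n _ _
    ... | false | []    = m≤m+n _ _
    ... | false | _ ∷ _ = ≤-reflexive (trans (cong suc (+-comm (size (codeELDAxiom η)) _)) (sym (+-suc _ _)))

    round-size : ∀ O K Z → size (codeAxioms (round O K Z)) ≤ size (codeAxioms Z) + size (codeAxioms K)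
    round-size O []      Z = m≤m+n _ _
    round-size O (η ∷ K) Z = begin
      size (codeAxioms (round O (η ∷ K) Z)) ≤⟨ addIfDerivable-size O η (round O K Z) ⟩
      size (codeAxioms (round O K Z)) + suc n ≤⟨ +-monoˡ-≤ (suc n) (round-size O K Z) ⟩
      size (codeAxioms Z) + size (codeAxioms K) + suc n ≡⟨ +-assoc (size (codeAxioms Z)) _ _ ⟩
      size (codeAxioms Z) + (size (codeAxioms K) + suc n) ≡⟨ cong (size (codeAxioms Z) +_) (trans (+-comm (size (codeAxioms K)) (suc n)) refl) ⟩
      size (codeAxioms Z) + size (codeAxioms (η ∷ K)) ∎
      where
      open ≤-Reasoning
      n = size (codeELDAxiom η)

    -- Stated for arbitrary `Z`, because the growth condition of a fold ranges over all inputs; an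
    -- axiom without source is merely dropped.
    line-labels-size : ∀ O Z → size (codeAxioms (map proj₁ (lines O Z))) ≤ size (codeAxioms Z)
    line-labels-size O []      = ≤-refl
    line-labels-size O (η ∷ Z) with sources O (map proj₁ (lines O Z)) η
    ... | []    = ≤-trans (line-labels-size O Z) (≤-trans (m≤n+m _ (size (codeELDAxiom η))) (n≤1+n _))
    ... | _ ∷ _ = s≤s (+-monoʳ-≤ (size (codeELDAxiom η)) (line-labels-size O Z))

    addIfDerivableᴾ : {o : A → ELDOntology} {z : A → List ELDAxiom} {f : A → ELDAxiom} →
                      PolyTime a codeAxioms o → PolyTime a codeELDAxiom f → PolyTime a codeAxioms z →
                      PolyTime a codeAxioms (λ γ → addIfDerivable (o γ) (f γ) (z γ))
    addIfDerivableᴾ O F Z = ifᴾ (F ∈ᴾ Z) Z (mapᴾ (take₁ᴾ (sourcesᴾ O Z F)) (π₁ ⟫ F) ++ᴾ Z)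

    roundᴾ : {o : A → ELDOntology} {k z : A → List ELDAxiom} →
             PolyTime a codeAxioms o → PolyTime a codeAxioms k → PolyTime a codeAxioms z →
             PolyTime a codeAxioms (λ γ → round (o γ) (k γ) (z γ))
    roundᴾ {o = o} {k} {z} O K Z = foldrᴾ {h = λ γ → addIfDerivable (o γ)} K Z
      (addIfDerivableᴾ (π₁ ⟫ O) (π₂ ⟫ π₁) (π₂ ⟫ π₂)) X
      λ γ η us → ≤-trans (addIfDerivable-size (o γ) η _)
        (+-monoʳ-≤ (size (codeAxioms (round (o γ) us (z γ)))) (≤-trans (s≤s (m≤m+n (size (codeELDAxiom η)) _)) (m≤n+m _ _)))

    saturateᴾ : {o : A → ELDOntology} {k t : A → List ELDAxiom} →
                PolyTime a codeAxioms o → PolyTime a codeAxioms k → PolyTime a codeAxioms t →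
                PolyTime a codeAxioms (λ γ → saturate (o γ) (k γ) (t γ))
    saturateᴾ {o = o} {k} O K T = foldrᴾ {h = λ γ _ → round (o γ) (k γ)} T (constᴾ [])
      (roundᴾ (π₁ ⟫ O) (π₁ ⟫ K) (π₂ ⟫ π₂)) (outputSize K)
      λ γ η us → ≤-trans (round-size (o γ) (k γ) _)
        (+-monoʳ-≤ (size (codeAxioms (saturate (o γ) (k γ) us)))
          (≤-trans (size-output K γ) (evalPoly-mono (outputSize K) (m≤m+n _ _))))

    newLineᴾ : {o : A → ELDOntology} {f : A → ELDAxiom} {z : A → List ELDAxiom} →
               PolyTime a codeAxioms o → PolyTime a codeELDAxiom f → PolyTime a codeAxioms z →
               PolyTime a (codeList codeLine) (λ γ → newLine (o γ) (f γ) (z γ))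
    newLineᴾ O F Z = take₁ᴾ (mapᴾ (sourcesᴾ O Z F) ((π₁ ⟫ F) ,ᴾ π₂))

    -- A new line depends on the accumulated lines through their labels only, and these are bounded
    -- by the input list. The justifications in the accumulator therefore do not feed back into the
    -- growth. The `const 1` is the outer pairing node of the argument of `L`.
    linesᴾ : {o : A → ELDOntology} {z : A → List ELDAxiom} →
             PolyTime a codeAxioms o → PolyTime a codeAxioms z →
             PolyTime a (codeList codeLine) (λ γ → lines (o γ) (z γ))
    linesᴾ {a = a} {o = o} {z} O Z =
      foldrᴾ {h = λ γ η ls → newLine (o γ) η (map proj₁ ls) ++ ls} Z (constᴾ [])
        (newLineᴾ (π₁ ⟫ O) (π₂ ⟫ π₁) (mapᴾ (π₂ ⟫ π₂) (π₂ ⟫ π₁)) ++ᴾ (π₂ ⟫ π₂)) (outputSize L ⟨ const 1 ⊕ X ⟩) grows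
      where
      L : PolyTime (codeProduct a (codeProduct codeAxioms codeELDAxiom)) (codeList codeLine)
                   (λ (γ , z , η) → newLine (o γ) η z)
      L = newLineᴾ (π₁ ⟫ O) (π₂ ⟫ π₂) (π₂ ⟫ π₁)
      open ≤-Reasoning
      grows : ∀ γ η us → let ls = lines (o γ) us in
              size (codeList codeLine (newLine (o γ) η (map proj₁ ls) ++ ls)) ≤
              size (codeList codeLine ls) + evalPoly (outputSize L ⟨ const 1 ⊕ X ⟩) (size (a γ) + size (codeAxioms (η ∷ us)))
      grows γ η us = let ls = lines (o γ) us in begin
        size (codeList codeLine (newLine (o γ) η (map proj₁ ls) ++ ls))
          ≤⟨ size-++ codeLine (newLine (o γ) η (map proj₁ ls)) ls ⟩
        size (codeList codeLine (newLine (o γ) η (map proj₁ ls))) + size (codeList codeLine ls)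
          ≡⟨ +-comm (size (codeList codeLine (newLine (o γ) η (map proj₁ ls)))) _ ⟩
        size (codeList codeLine ls) + size (codeList codeLine (newLine (o γ) η (map proj₁ ls)))
          ≤⟨ +-monoʳ-≤ (size (codeList codeLine ls)) (size-output L (γ , map proj₁ ls , η)) ⟩
        size (codeList codeLine ls) + evalPoly (outputSize L) (suc (size (a γ) + suc (size (codeAxioms (map proj₁ ls)) + size (codeELDAxiom η))))
          ≤⟨ +-monoʳ-≤ (size (codeList codeLine ls)) (evalPoly-mono (outputSize L) (s≤s (+-monoʳ-≤ (size (a γ)) (s≤s (≤-trans (+-monoˡ-≤ (size (codeELDAxiom η)) (line-labels-size (o γ) us)) (≤-reflexive (+-comm (size (codeAxioms us)) _))))))) ⟩
        size (codeList codeLine ls) + evalPoly (outputSize L) (suc (size (a γ) + size (codeAxioms (η ∷ us))))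
          ≡⟨ cong (size (codeList codeLine ls) +_) (sym (evalPoly-⟨⟩ (outputSize L) (const 1 ⊕ X) _)) ⟩
        size (codeList codeLine ls) + evalPoly (outputSize L ⟨ const 1 ⊕ X ⟩) (size (a γ) + size (codeAxioms (η ∷ us))) ∎

    concat-size : ∀ (pss : List (List ELDAxiom)) → size (codeAxioms (concat pss)) ≤ size (codeSteps pss)
    concat-size []         = ≤-refl
    concat-size (ps ∷ pss) = ≤-trans (size-++ codeELDAxiom ps (concat pss))
      (≤-trans (+-monoʳ-≤ (size (codeAxioms ps)) (concat-size pss)) (n≤1+n _))

    -- A kept line enters the state twice, by its premises in the first component and as a whole in
    -- the second.
    keepIfNeeded-size : ∀ l v → size (codePruned (keepIfNeeded l v)) ≤
                        size (codePruned v) + (suc (size (codeLine l)) + suc (size (codeLine l)))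
    keepIfNeeded-size l@(η , pss) (nd , kept) with does (η ∈? nd)
    ... | false = m≤m+n _ _
    ... | true  = begin
      suc (size (codeAxioms (concat pss ++ nd)) + suc (size (codeLine l) + size (codeList codeLine kept)))
        ≤⟨ s≤s (+-monoˡ-≤ _ (≤-trans (size-++ codeELDAxiom (concat pss) nd) (+-monoˡ-≤ (size (codeAxioms nd)) concat≤))) ⟩
      suc (suc (size (codeLine l)) + size (codeAxioms nd) + suc (size (codeLine l) + size (codeList codeLine kept)))
        ≡⟨ rearrange (suc (size (codeLine l))) (size (codeAxioms nd)) (size (codeLine l)) (size (codeList codeLine kept)) ⟩
      suc (size (codeAxioms nd) + size (codeList codeLine kept)) + (suc (size (codeLine l)) + suc (size (codeLine l))) ∎
      where
      open ≤-Reasoning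
      concat≤ : size (codeAxioms (concat pss)) ≤ suc (size (codeLine l))
      concat≤ = ≤-trans (concat-size pss) (≤-trans (m≤n+m _ (size (codeELDAxiom η))) (≤-trans (n≤1+n _) (n≤1+n _)))
      rearrange : ∀ k m n o → suc (k + m + suc (n + o)) ≡ suc (m + o) + (k + suc n)
      rearrange = ℕ-solver.solve-∀

    pruneᴾ : {f : A → ELDAxiom} {l : A → List Line} →
             PolyTime a codeELDAxiom f → PolyTime a (codeList codeLine) l →
             PolyTime a (codeList codeLine) (λ γ → prune (f γ) (l γ))
    pruneᴾ {a = a} {f = f} F L = reverseᴾ (foldr-reverseᴾ {h = λ _ → keepIfNeeded} L ([ F ]ᴾ ,ᴾ constᴾ [])
      (ifᴾ ((π₂ ⟫ π₁ ⟫ π₁) ∈ᴾ (π₂ ⟫ π₂ ⟫ π₁))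
        ((concatᴾ (π₂ ⟫ π₁ ⟫ π₂) ++ᴾ (π₂ ⟫ π₂ ⟫ π₁)) ,ᴾ ([ π₂ ⟫ π₁ ]ᴾ ++ᴾ (π₂ ⟫ π₂ ⟫ π₂)))
        (π₂ ⟫ π₂)) (X ⊕ X) (λ γ l us → let v = foldr keepIfNeeded (f γ ∷ [] , []) us in
          ≤-trans (keepIfNeeded-size l v) (+-monoʳ-≤ (size (codePruned v)) (+-mono-≤ (fits γ l us) (fits γ l us)))) ⟫ π₂)
      where
      fits : ∀ γ l us → suc (size (codeLine l)) ≤ size (a γ) + size (codeList codeLine (l ∷ us))
      fits γ l us = ≤-trans (s≤s (m≤m+n (size (codeLine l)) _)) (m≤n+m _ _)

    indexOfᴾ : {f : A → ELDAxiom} {l : A → List ELDAxiom} →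
               PolyTime a codeELDAxiom f → PolyTime a codeAxioms l →
               PolyTime a codeℕ (λ γ → indexOf (f γ) (l γ))
    indexOfᴾ {f = f} F L = foldrᴾ {h = λ γ θ n → if does (f γ ≟ θ) then 0 else suc n} L (constᴾ 0)
      (ifᴾ (≟ᴾ (π₁ ⟫ F) (π₂ ⟫ π₁)) (constᴾ 0) (fromRaw (raw,ᴾ (constᴰ nil) (toRaw (π₂ ⟫ π₂)))))
      (const 2) λ γ θ us → grows (does (f γ ≟ θ)) _
      where
      grows : ∀ t n → size (codeℕ (if t then 0 else suc n)) ≤ size (codeℕ n) + 2
      grows true  n = ≤-trans (size≥1 (codeℕ n)) (m≤m+n _ _)
      grows false n = ≤-reflexive (+-comm 2 (size (codeℕ n)))

    edgesOfᴾ : {l : A → List Line} → PolyTime a (codeList codeLine) l →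
               PolyTime a codeEdges (λ γ → edgesOf (l γ))
    edgesOfᴾ L = concatMapᴾ L (mapᴾ (π₂ ⟫ π₂)
      (mapᴾ (labelsᴾ (π₁ ⟫ π₁ ⟫ L)) (π₂ ∈ᴾ (π₁ ⟫ π₂)) ,ᴾ indexOfᴾ (π₁ ⟫ π₂ ⟫ π₁) (labelsᴾ (π₁ ⟫ π₁ ⟫ L))))
      where
      labelsᴾ : {l : A → List Line} → PolyTime a (codeList codeLine) l → PolyTime a codeAxioms (λ γ → map proj₁ (l γ))
      labelsᴾ L = mapᴾ L (π₂ ⟫ π₁)

    -- Correctness of the saturation

    conclusions₁-sound : ∀ O {η} θ → η ∈ conclusions₁ θ → ELDRule O (θ ∷ []) η
    conclusions₁-sound O (C ⊑ D ⊓ E) (here refl)         = elk (R⊓⁻ {Ds = D ∷ E ∷ []} (here refl))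
    conclusions₁-sound O (C ⊑ D ⊓ E) (there (here refl)) = elk (R⊓⁻ {Ds = D ∷ E ∷ []} (there (here refl)))

    conclusions₂-sound : ∀ O {η} θ₁ θ₂ → η ∈ conclusions₂ O θ₁ θ₂ → ELDRule O (θ₁ ∷ θ₂ ∷ []) η
    conclusions₂-sound O (C ⊑ D) (C′ ⊑ E) η∈ with ∈-++⁻ (when (does ((D ≟ᶜ C′) ×-dec ((C′ ⊑ E) ∈? O))) _) η∈
    ... | inj₁ p with ∈-when⁻ ((D ≟ᶜ C′) ×-dec ((C′ ⊑ E) ∈? O)) p
    ...   | (refl , θ∈O) , here refl = elk (R⊑ θ∈O)
    conclusions₂-sound O (C ⊑ D) (C′ ⊑ E) η∈ | inj₂ p with ∈-++⁻ (when (does (C ≟ᶜ C′)) _) p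
    ... | inj₁ q with ∈-when⁻ (C ≟ᶜ C′) q
    ...   | refl , here refl = elk R⊓⁺
    conclusions₂-sound O (C ⊑ some r D) (C′ ⊑ E) η∈ | inj₂ p | inj₂ q with ∈-++⁻ (when (does (D ≟ᶜ C′)) _) q
    ... | inj₁ s with ∈-when⁻ (D ≟ᶜ C′) s
    ...   | refl , here refl = elk R∃
    ...   | refl , there t with ∈-when⁻ (E ≟ᶜ ⊥) t
    ...     | refl , here refl = elk R⊥

    asConstraint-sound : ∀ D {δ} → δ ∈ asConstraint D → D ≡ concept δ
    asConstraint-sound ⊥     (here refl) = refl
    asConstraint-sound [ α ] (here refl) = refl

    asConstraint-complete : ∀ δ → δ ∈ asConstraint (concept δ)
    asConstraint-complete ⊥ᵖ       = here refl
    asConstraint-complete (atom α) = here refl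

    knownConstraints-sound : ∀ Z C {γ} → γ ∈ knownConstraints Z C → (C ⊑ concept γ) ∈ Z
    knownConstraints-sound Z C γ∈ with concatMap-∈⁻ Z γ∈
    ... | (C′ ⊑ D) , η∈ , p with ∈-when⁻ (C′ ≟ᶜ C) p
    ...   | refl , q = subst (λ E → (C ⊑ E) ∈ Z) (asConstraint-sound D q) η∈

    knownConstraints-complete : ∀ Z C γ → (C ⊑ concept γ) ∈ Z → γ ∈ knownConstraints Z C
    knownConstraints-complete Z C γ η∈ = concatMap-∈⁺ Z η∈ (∈-when⁺ (C ≟ᶜ C) refl (asConstraint-complete γ))

    steps-sound : ∀ O Z η {ps} → ps ∈ steps O Z η → ELDRule O ps η × ps ⊆ Z
    steps-sound O Z (C ⊑ D) ps∈ with ∈-++⁻ (when (does (D ≟ᶜ C)) _) ps∈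
    ... | inj₁ p with ∈-when⁻ (D ≟ᶜ C) p
    ...   | refl , here refl = elk R₀ , λ ()
    steps-sound O Z (C ⊑ D) ps∈ | inj₂ p with ∈-++⁻ (when (does (D ≟ᶜ ⊤)) _) p
    ... | inj₁ q with ∈-when⁻ (D ≟ᶜ ⊤) q
    ...   | refl , here refl = elk R⊤ , λ ()
    steps-sound O Z (C ⊑ D) ps∈ | inj₂ p | inj₂ q with ∈-++⁻ (concatMap _ (asConstraint D)) q
    ... | inj₁ r with concatMap-∈⁻ (asConstraint D) r
    ...   | δ , δ∈ , s with ∈-when⁻ (valid? (knownConstraints Z C , δ ∷ [])) s
    ...     | valid , here refl = subst (λ E → ELDRule O _ (C ⊑ E)) (sym (asConstraint-sound D δ∈)) (cd valid) , ⊆Z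
      where
      ⊆Z : map (λ γ → C ⊑ concept γ) (knownConstraints Z C) ⊆ Z
      ⊆Z θ∈ with ∈-map⁻ _ θ∈
      ... | γ , γ∈ , refl = knownConstraints-sound Z C γ∈
    steps-sound O Z η@(C ⊑ D) ps∈ | inj₂ p | inj₂ q | inj₂ r with concatMap-∈⁻ Z r
    ... | θ₁ , θ₁∈ , s with ∈-++⁻ (when (does (η ∈? conclusions₁ θ₁)) _) s
    ...   | inj₁ t with ∈-when⁻ (η ∈? conclusions₁ θ₁) t
    ...     | u , here refl = conclusions₁-sound O θ₁ u , λ { (here refl) → θ₁∈ }
    steps-sound O Z η@(C ⊑ D) ps∈ | inj₂ p | inj₂ q | inj₂ r | θ₁ , θ₁∈ , s | inj₂ t with concatMap-∈⁻ Z t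
    ... | θ₂ , θ₂∈ , u with ∈-when⁻ (η ∈? conclusions₂ O θ₁ θ₂) u
    ...   | v , here refl = conclusions₂-sound O θ₁ θ₂ v , λ { (here refl) → θ₁∈ ; (there (here refl)) → θ₂∈ }

    data Justified (O : ELDOntology) (Z : List ELDAxiom) (η : ELDAxiom) : List (List ELDAxiom) → Set where
      leaf : η ∈ O → Justified O Z η []
      step : ∀ {ps} → ELDRule O ps η → ps ⊆ Z → Justified O Z η (ps ∷ [])

    sources-sound : ∀ O Z η {s} → s ∈ sources O Z η → Justified O Z η s
    sources-sound O Z η s∈ with ∈-++⁻ (when (does (η ∈? O)) _) s∈
    ... | inj₁ p with ∈-when⁻ (η ∈? O) p
    ...   | η∈O , here refl = leaf η∈O
    sources-sound O Z η s∈ | inj₂ p with ∈-map⁻ _ p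
    ... | ps , ps∈ , refl with steps-sound O Z η ps∈
    ...   | rule , ⊆Z = step rule ⊆Z

    step-source : ∀ O Z η {ps} → ps ∈ steps O Z η → (ps ∷ []) ∈ sources O Z η
    step-source O Z η ps∈ = ∈-++⁺ʳ (when (does (η ∈? O)) _) (∈-map⁺ (_∷ []) ps∈)

    data Derived (O : ELDOntology) : List ELDAxiom → Set where
      []  : Derived O []
      add : ∀ {η s Z} → η ∉ Z → s ∈ sources O Z η → Derived O Z → Derived O (η ∷ Z)

    -- The possible outcomes of `addIfDerivable`. The first records that leaving the list unchanged
    -- certifies closure at `η`.
    data Added (O : ELDOntology) (η : ELDAxiom) (Z : List ELDAxiom) : List ELDAxiom → Set where
      same : (∀ {s} → s ∈ sources O Z η → η ∈ Z) → Added O η Z Z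
      new  : ∀ {s} → η ∉ Z → s ∈ sources O Z η → Added O η Z (η ∷ Z)

    addIfDerivable-added : ∀ O η Z → Added O η Z (addIfDerivable O η Z)
    addIfDerivable-added O η Z with η ∈? Z | sources O Z η in e
    ... | yes η∈ | _     = same (λ _ → η∈)
    ... | no η∉  | []    = same (λ s∈ → ⊥-elim (¬Any[] (subst (_ ∈_) e s∈)))
    ... | no η∉  | s ∷ _ = new η∉ (subst (s ∈_) (sym e) (here refl))

    addIfDerivable-derived : ∀ O η {Z} → Derived O Z → Derived O (addIfDerivable O η Z)
    addIfDerivable-derived O η {Z} d with addIfDerivable O η Z | addIfDerivable-added O η Z
    ... | _ | same _    = d
    ... | _ | new η∉ s∈ = add η∉ s∈ d

    round-derived : ∀ O K {Z} → Derived O Z → Derived O (round O K Z)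
    round-derived O []      d = d
    round-derived O (η ∷ K) d = addIfDerivable-derived O η (round-derived O K d)

    saturate-derived : ∀ O K ticks → Derived O (saturate O K ticks)
    saturate-derived O K []          = []
    saturate-derived O K (_ ∷ ticks) = round-derived O K (saturate-derived O K ticks)

    round-⊆ : ∀ O K {K′ Z} → K ⊆ K′ → Z ⊆ K′ → round O K Z ⊆ K′
    round-⊆ O []      K⊆ Z⊆ = Z⊆
    round-⊆ O (η ∷ K) {Z = Z} K⊆ Z⊆ with addIfDerivable O η (round O K Z) | addIfDerivable-added O η (round O K Z)
    ... | _ | same _  = round-⊆ O K (λ x → K⊆ (there x)) Z⊆
    ... | _ | new _ _ = λ { (here refl) → K⊆ (here refl) ; (there x) → round-⊆ O K (λ x → K⊆ (there x)) Z⊆ x }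

    saturate-⊆ : ∀ O K ticks → saturate O K ticks ⊆ K
    saturate-⊆ O K []          = λ ()
    saturate-⊆ O K (_ ∷ ticks) = round-⊆ O K (λ x → x) (saturate-⊆ O K ticks)

    round-grows : ∀ O K Z → length Z ≤ length (round O K Z)
    round-grows O []      Z = ≤-refl
    round-grows O (η ∷ K) Z with addIfDerivable O η (round O K Z) | addIfDerivable-added O η (round O K Z)
    ... | _ | same _  = round-grows O K Z
    ... | _ | new _ _ = ≤-trans (round-grows O K Z) (n≤1+n _)

    Closed : ELDOntology → List ELDAxiom → List ELDAxiom → Set
    Closed O K Z = ∀ {η s} → η ∈ K → s ∈ sources O Z η → η ∈ Z

    -- Nothing is ever removed, so a round that does not lengthen the list leaves it unchanged at
    -- every candidate. Each candidate has then been tested against the final list.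
    round-stable : ∀ O K Z → length (round O K Z) ≤ length Z → round O K Z ≡ Z × Closed O K Z
    round-stable O []      Z le = refl , λ ()
    round-stable O (η ∷ K) Z le with addIfDerivable O η (round O K Z) | addIfDerivable-added O η (round O K Z)
    ... | _ | new _ _ = ⊥-elim (1+n≰n (≤-trans le (round-grows O K Z)))
    ... | _ | same closed with round-stable O K Z le
    ...   | e , closed′ = e , λ { {s = s} (here refl) s∈ → subst (η ∈_) e (closed (subst (λ Z → s ∈ sources O Z η) (sym e) s∈))
                                ; (there η∈) s∈ → closed′ η∈ s∈ }

    -- Either every round so far has added an axiom, or some round added none, and from then on the
    -- list stays the same.
    saturate-stable : ∀ O K ticks → let Z = saturate O K ticks in
                      length ticks ≤ length Z ⊎ length (round O K Z) ≤ length Z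
    saturate-stable O K []          = inj₁ z≤n
    saturate-stable O K (_ ∷ ticks) with saturate-stable O K ticks
    ... | inj₂ le = inj₂ (≤-reflexive (cong (λ Z → length (round O K Z)) (proj₁ (round-stable O K _ le))))
    ... | inj₁ le with length (round O K (saturate O K ticks)) ≤? length (saturate O K ticks)
    ...   | yes le′ = inj₂ (≤-reflexive (cong (λ Z → length (round O K Z)) (proj₁ (round-stable O K _ le′))))
    ...   | no ≰    = inj₁ (≤-trans (s≤s le) (≰⇒> ≰))

    -- Pigeonhole principle: a derived list has no repetitions, so its head can be removed from `K`
    -- before recursing on its tail.
    derived-length : ∀ O K {Z} → Derived O Z → Z ⊆ K → length Z ≤ length K
    derived-length O K [] Z⊆ = z≤n
    derived-length O K (add {η} {Z = Z} η∉ _ d) Z⊆ with ∈-∃++ (Z⊆ (here refl))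
    ... | K₁ , K₂ , refl = ≤-trans (s≤s (derived-length O (K₁ ++ K₂) d Z⊆′)) (≤-reflexive (sym length-K))
      where
      length-K : length (K₁ ++ η ∷ K₂) ≡ suc (length (K₁ ++ K₂))
      length-K = trans (length-++ K₁) (trans (+-suc (length K₁) _) (cong suc (sym (length-++ K₁))))
      Z⊆′ : Z ⊆ K₁ ++ K₂
      Z⊆′ θ∈ with ∈-++⁻ K₁ (Z⊆ (there θ∈))
      ... | inj₁ p           = ∈-++⁺ˡ p
      ... | inj₂ (here refl) = ⊥-elim (η∉ θ∈)
      ... | inj₂ (there p)   = ∈-++⁺ʳ K₁ p

    -- `η` only provides one round more than `K` has entries, and so many rounds cannot all add a
    -- new element of `K`.
    saturate-closed : ∀ O K η → Closed O K (saturate O K (η ∷ K))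
    saturate-closed O K η with saturate-stable O K (η ∷ K)
    ... | inj₁ le = ⊥-elim (1+n≰n (≤-trans le (derived-length O K (saturate-derived O K (η ∷ K)) (saturate-⊆ O K (η ∷ K)))))
    ... | inj₂ le = proj₂ (round-stable O K _ le)

    -- From derivations to hypergraphs

    labels : List Line → List ELDAxiom
    labels = map proj₁

    data Ordered (O : ELDOntology) : List Line → Set where
      []  : Ordered O []
      add : ∀ {η s ls} → η ∉ labels ls → Justified O (labels ls) η s → Ordered O ls → Ordered O ((η , s) ∷ ls)

    -- The labels below an axiom are exactly the list to which it was added, so the search for a
    -- source cannot fail.
    lines-ordered : ∀ O {Z} → Derived O Z → labels (lines O Z) ≡ Z × Ordered O (lines O Z)
    lines-ordered O [] = refl , []
    lines-ordered O (add {η} {Z = Z} η∉ s∈ d) with lines O Z | lines-ordered O d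
    ... | ls | refl , ord with sources O (labels ls) η in e
    ...   | s ∷ _ = refl , add η∉ (sources-sound O (labels ls) η (subst (s ∈_) (sym e) (here refl))) ord
    ...   | []    = ⊥-elim (¬Any[] s∈)

    -- Dropping the lines on which the goal does not depend

    -- `prune` as a recursion from the front, without accumulated lines. Premises come after their
    -- conclusions, so all demand for a line is known when it is reached.
    needed : List ELDAxiom → List Line → List Line
    needed nd []       = []
    needed nd (l ∷ ls) =
      if does (proj₁ l ∈? nd) then l ∷ needed (concat (proj₂ l) ++ nd) ls else needed nd ls

    prune-needed : ∀ η ls → prune η ls ≡ needed (η ∷ []) ls
    prune-needed η ls = trans
      (cong (λ v → reverse (proj₂ v)) (reverse-foldr keepIfNeeded (η ∷ [] , []) ls))
      (accumulate (η ∷ []) [] ls)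
      where
      accumulate : ∀ nd kept ls →
        reverse (proj₂ (foldl (λ v l → keepIfNeeded l v) (nd , kept) ls)) ≡ kept ʳ++ needed nd ls
      accumulate nd kept []       = refl
      accumulate nd kept (l ∷ ls) with does (proj₁ l ∈? nd)
      ... | true  = accumulate (concat (proj₂ l) ++ nd) (l ∷ kept) ls
      ... | false = accumulate nd kept ls

    needed-complete : ∀ nd ls {η} → η ∈ nd → η ∈ labels ls → η ∈ labels (needed nd ls)
    needed-complete nd (l ∷ ls) η∈nd η∈ with proj₁ l ∈? nd
    needed-complete nd (l ∷ ls) η∈nd (here refl) | yes _ = here refl
    needed-complete nd (l ∷ ls) η∈nd (there η∈)  | yes _ =
      there (needed-complete (concat (proj₂ l) ++ nd) ls (∈-++⁺ʳ (concat (proj₂ l)) η∈nd) η∈)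
    needed-complete nd (l ∷ ls) η∈nd (here refl) | no ∉nd = ⊥-elim (∉nd η∈nd)
    needed-complete nd (l ∷ ls) η∈nd (there η∈)  | no _ = needed-complete nd ls η∈nd η∈

    needed-⊆ : ∀ nd ls → labels (needed nd ls) ⊆ labels ls
    needed-⊆ nd (l ∷ ls) η∈ with does (proj₁ l ∈? nd)
    needed-⊆ nd (l ∷ ls) (here refl) | true  = here refl
    needed-⊆ nd (l ∷ ls) (there η∈)  | true  = there (needed-⊆ (concat (proj₂ l) ++ nd) ls η∈)
    needed-⊆ nd (l ∷ ls) η∈          | false = there (needed-⊆ nd ls η∈)

    needed-ordered : ∀ O nd {ls} → Ordered O ls → Ordered O (needed nd ls)
    needed-ordered O nd [] = []
    needed-ordered O nd (add {η} {s} {ls} η∉ j ord) with does (η ∈? nd)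
    ... | false = needed-ordered O nd ord
    ... | true  = add (λ η∈ → η∉ (needed-⊆ _ ls η∈)) (restrict j) (needed-ordered O (concat s ++ nd) ord)
      where
      restrict : Justified O (labels ls) η s → Justified O (labels (needed (concat s ++ nd) ls)) η s
      restrict (leaf η∈O)       = leaf η∈O
      -- The demand `concat (ps ∷ []) ++ nd` is `(ps ++ []) ++ nd`, hence two injections.
      restrict (step {ps} r ⊆Z) = step r λ θ∈ → needed-complete _ ls (∈-++⁺ˡ (∈-++⁺ˡ θ∈)) (⊆Z θ∈)

    -- The source of the uniqueness of the sink: what was not demanded from outside was kept as a
    -- premise of another kept line.
    needed-used : ∀ nd ls {η} → η ∈ labels (needed nd ls) →
                  η ∈ nd ⊎ ∃[ l ] l ∈ needed nd ls × η ∈ concat (proj₂ l)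
    needed-used nd (l ∷ ls) η∈ with proj₁ l ∈? nd
    needed-used nd (l ∷ ls) (here refl) | yes ∈nd = inj₁ ∈nd
    needed-used nd (l ∷ ls) (there η∈)  | yes ∈nd with needed-used (concat (proj₂ l) ++ nd) ls η∈
    ... | inj₂ (l′ , l′∈ , p) = inj₂ (l′ , there l′∈ , p)
    ... | inj₁ p with ∈-++⁻ (concat (proj₂ l)) p
    ...   | inj₁ q = inj₂ (l , here refl , q)
    ...   | inj₂ q = inj₁ q
    needed-used nd (l ∷ ls) η∈ | no _ = needed-used nd ls η∈

    -- As long as only the goal is demanded, every other line is dropped. The goal thus becomes the
    -- first line, which will be vertex `zero`.
    needed-head : ∀ η nd ls → η ∈ nd → (∀ {θ} → θ ∈ nd → θ ≡ η) → η ∈ labels ls →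
                  ∃[ s ] ∃[ ls′ ] needed nd ls ≡ (η , s) ∷ ls′
    needed-head η nd (l ∷ ls) η∈nd only η∈ with proj₁ l ∈? nd
    needed-head η nd (l ∷ ls) η∈nd only η∈          | yes p = proj₂ l , _ , cong (λ θ → (θ , proj₂ l) ∷ _) (only p)
    needed-head η nd (l ∷ ls) η∈nd only (here refl) | no ∉nd = ⊥-elim (∉nd η∈nd)
    needed-head η nd (l ∷ ls) η∈nd only (there η∈)  | no _   = needed-head η nd ls η∈nd only η∈

    -- The hypergraph of an ordered list of lines

    module Graph (O : ELDOntology) (ls : List Line) (ord : Ordered O ls) where

      n : ℕ
      n = length ls

      labelOf : Fin n → ELDAxiom
      labelOf i = proj₁ (lookup ls i)

      sourceOf : Fin n → List (List ELDAxiom)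
      sourceOf i = proj₂ (lookup ls i)

      premiseSet : List ELDAxiom → Subset n
      premiseSet ps = Vec.tabulate (λ i → does (labelOf i ∈? ps))

      graph : Hypergraph ELDAxiom
      graph = record
        { #V    = n
        ; label = labelOf
        ; edges = concatMap (λ i → map (λ ps → premiseSet ps , i) (sourceOf i)) (allFin n)
        }

      open Hypergraph graph using (edges; Premise; IsLeaf; IsSink)

      ∈-labels : ∀ {ls : List Line} {η} → η ∈ labels ls → ∃[ i ] proj₁ (lookup ls i) ≡ η
      ∈-labels {_ ∷ _} (here refl) = zero , refl
      ∈-labels {_ ∷ _} (there η∈) with ∈-labels η∈
      ... | i , e = suc i , e

      labels-∈ : ∀ (ls : List Line) i → proj₁ (lookup ls i) ∈ labels ls
      labels-∈ (_ ∷ _)  zero    = here refl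
      labels-∈ (_ ∷ ls) (suc i) = there (labels-∈ ls i)

      label-injective : ∀ {ls} → Ordered O ls → ∀ i j → proj₁ (lookup ls i) ≡ proj₁ (lookup ls j) → i ≡ j
      label-injective (add η∉ _ ord) zero    zero    e = refl
      label-injective (add {ls = ls} η∉ _ ord) zero    (suc j) e = ⊥-elim (η∉ (subst (_∈ labels ls) (sym e) (labels-∈ ls j)))
      label-injective (add {ls = ls} η∉ _ ord) (suc i) zero    e = ⊥-elim (η∉ (subst (_∈ labels ls) e (labels-∈ ls i)))
      label-injective (add η∉ _ ord) (suc i) (suc j) e = cong suc (label-injective ord i j e)

      -- Indices strictly decrease from premise to conclusion, which excludes cycles; that a line
      -- has a single source gives at most one inference per label.
      premises-later : ∀ {ls} → Ordered O ls → ∀ d {ps} → ps ∈ proj₂ (lookup ls d) →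
                       proj₂ (lookup ls d) ≡ ps ∷ [] × ELDRule O ps (proj₁ (lookup ls d)) ×
                       (∀ {η} → η ∈ ps → ∃[ i ] toℕ d < toℕ i × proj₁ (lookup ls i) ≡ η)
      premises-later (add _ (step r ⊆Z) ord) zero (here refl) = refl , r , λ η∈ →
        let i , e = ∈-labels (⊆Z η∈) in suc i , s≤s z≤n , e
      premises-later (add _ _ ord) (suc d) ps∈ =
        let e , r , later = premises-later ord d ps∈
        in e , r , λ η∈ → let i , d<i , e′ = later η∈ in suc i , s≤s d<i , e′

      leaf-axiom : ∀ {ls} → Ordered O ls → ∀ i → (∀ {ps} → ps ∉ proj₂ (lookup ls i)) → proj₁ (lookup ls i) ∈ O
      leaf-axiom (add _ (leaf η∈O) _) zero    ∉s = η∈O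
      leaf-axiom (add _ (step _ _) _) zero    ∉s = ⊥-elim (∉s (here refl))
      leaf-axiom (add _ _ ord)        (suc i) ∉s = leaf-axiom ord i ∉s

      edge⁻ : ∀ {T d} → (T , d) ∈ edges → ∃[ ps ] ps ∈ sourceOf d × T ≡ premiseSet ps
      edge⁻ e∈ with concatMap-∈⁻ (allFin n) e∈
      ... | i , _ , p with ∈-map⁻ _ p
      ...   | ps , ps∈ , refl = ps , ps∈ , refl

      edge⁺ : ∀ {d ps} → ps ∈ sourceOf d → (premiseSet ps , d) ∈ edges
      edge⁺ {d} ps∈ = concatMap-∈⁺ (allFin n) (∈-allFin d) (∈-map⁺ _ ps∈)

      premiseSet⁻ : ∀ {ps i} → i ∈ˢ premiseSet ps → labelOf i ∈ ps
      premiseSet⁻ {ps} {i} i∈ with labelOf i ∈? ps | trans (sym (lookup∘tabulate (λ i → does (labelOf i ∈? ps)) i)) ([]=⇒lookup i∈)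
      ... | yes p | _ = p

      premiseSet⁺ : ∀ {ps i} → labelOf i ∈ ps → i ∈ˢ premiseSet ps
      premiseSet⁺ {ps} {i} ∈ps = lookup⇒[]= i (premiseSet ps)
        (trans (lookup∘tabulate (λ i → does (labelOf i ∈? ps)) i) (dec-true (labelOf i ∈? ps) ∈ps))

      premise-later : ∀ {i d} → Premise i d → toℕ d < toℕ i
      premise-later {i} {d} (T , e∈ , i∈) with edge⁻ e∈
      ... | ps , ps∈ , refl with premises-later ord d ps∈
      ...   | _ , _ , later with later (premiseSet⁻ {ps} i∈)
      ...     | j , d<j , e = subst (λ k → toℕ d < toℕ k) (label-injective ord j i e) d<j

      ancestor-later : ∀ {i d} → TransClosure Premise i d → toℕ d < toℕ i
      ancestor-later [ p ]    = premise-later p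
      ancestor-later (p ∷ ps) = <-trans (ancestor-later ps) (premise-later p)

      -- The list `ps` retains the order and the repetitions that the rule asks for and the premise
      -- set forgets. Labels being injective, its vertices are exactly that set.
      inferences : ∀ T d → (T , d) ∈ edges → Σ[ vs ∈ List (Fin n) ]
                     (∀ v → v ∈ˢ T ⇔ v ∈ vs) × ELDRule O (map labelOf vs) (labelOf d)
      inferences T d e∈ with edge⁻ e∈
      ... | ps , ps∈ , refl with premises-later ord d ps∈
      ...   | _ , rule , later with enumerate ps (λ η∈ → let i , _ , e = later η∈ in i , e)
        where
        enumerate : ∀ ps → (∀ {η} → η ∈ ps → ∃[ i ] labelOf i ≡ η) → ∃[ vs ] map labelOf vs ≡ ps
        enumerate []       f = [] , refl
        enumerate (p ∷ ps) f =
          let i , e = f (here refl) ; vs , es = enumerate ps (λ η∈ → f (there η∈)) in i ∷ vs , cong₂ _∷_ e es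
      ...     | vs , refl = vs , (λ v → mk⇔ (λ v∈ → unmap (premiseSet⁻ {map labelOf vs} v∈)) (λ v∈ → premiseSet⁺ (∈-map⁺ labelOf v∈))) , rule
        where
        unmap : ∀ {v} → labelOf v ∈ map labelOf vs → v ∈ vs
        unmap {v} p with ∈-map⁻ labelOf p
        ... | u , u∈ , e = subst (_∈ vs) (label-injective ord u v (sym e)) u∈

      unique : ∀ T d T′ d′ → (T , d) ∈ edges → (T′ , d′) ∈ edges → labelOf d ≡ labelOf d′ → (T , d) ≡ (T′ , d′)
      unique T d T′ d′ p q e with label-injective ord d d′ e
      ... | refl with edge⁻ p | edge⁻ q
      ...   | ps , ps∈ , refl | qs , qs∈ , refl
              with refl ← ∷-injectiveˡ (trans (sym (proj₁ (premises-later ord d ps∈))) (proj₁ (premises-later ord d qs∈))) = refl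

      leaves : ∀ v → IsLeaf v → labelOf v ∈ O
      leaves v isLeaf = leaf-axiom ord v λ ps∈ → isLeaf _ v (edge⁺ ps∈) refl

      isProof : ∀ {η s ls′} → ls ≡ (η , s) ∷ ls′ →
                (∀ {θ} → θ ∈ labels ls → θ ∈ η ∷ [] ⊎ ∃[ l ] l ∈ ls × θ ∈ concat (proj₂ l)) →
                IsELDProof O η graph
      isProof {η} refl used = record
        { acyclic    = λ v c → n≮n _ (ancestor-later c)
        ; sink       = zero
        ; sink-sink  = λ T d e∈ 0∈ → n≮0 (premise-later (T , e∈ , 0∈))
        ; sink-only  = only
        ; sink-label = refl
        ; unique     = unique
        ; leaves     = leaves
        ; inferences = inferences
        }
        where
        only : ∀ v → IsSink v → v ≡ zero
        only v isSink with used (labels-∈ ls v)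
        ... | inj₁ (here e) = label-injective ord v zero e
        ... | inj₂ (l , l∈ , p) with ∈-lookup⁻ l∈ | concatMap-∈⁻ (proj₂ l) (subst (labelOf v ∈_) (cong concat (sym (map-id (proj₂ l)))) p)
          where
          ∈-lookup⁻ : ∀ {l : Line} {ls} → l ∈ ls → ∃[ i ] lookup ls i ≡ l
          ∈-lookup⁻ l∈ = index l∈ , sym (lookup-index l∈)
        ...   | i , refl | ps , ps∈ , q = ⊥-elim (isSink _ i (edge⁺ ps∈) (premiseSet⁺ q))

      indexOf-labelOf : ∀ {ls} → Ordered O ls → ∀ i → indexOf (proj₁ (lookup ls i)) (labels ls) ≡ toℕ i
      indexOf-labelOf (add {η} _ _ ord) zero with η ≟ η
      ... | yes _ = refl
      ... | no ≢  = ⊥-elim (≢ refl)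
      indexOf-labelOf (add {η} {ls = ls} η∉ _ ord) (suc i) with proj₁ (lookup ls i) ≟ η
      ... | yes refl = ⊥-elim (η∉ (labels-∈ ls i))
      ... | no _     = cong suc (indexOf-labelOf ord i)

      map-allFin : ∀ {B : Set} (f : Line → B) → map (λ i → f (lookup ls i)) (allFin n) ≡ map f ls
      map-allFin f = trans (map-∘ (allFin n)) (cong (map f) (trans (map-tabulate (λ i → i) (lookup ls)) (tabulate-lookup ls)))

      -- Connects the tree that the program can build with the dependently typed graph that is
      -- proved correct.
      codeGraph : codeOutput graph ≡ codeProduct codeAxioms codeEdges (labels ls , edgesOf ls)
      codeGraph = cong₂ _∙_ (cong codeAxioms (map-allFin proj₁)) (codeList-map (begin
        map codeEdge (concatMap (λ i → map (λ ps → premiseSet ps , i) (sourceOf i)) (allFin n))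
          ≡⟨ map-concatMap codeEdge _ (allFin n) ⟩
        concatMap (λ i → map codeEdge (map (λ ps → premiseSet ps , i) (sourceOf i))) (allFin n)
          ≡⟨ concatMap-cong (λ i → trans (sym (map-∘ (sourceOf i))) (trans (map-cong (sameCode i) (sourceOf i)) (map-∘ (sourceOf i)))) (allFin n) ⟩
        concatMap (λ i → map codeEdge′ (edgesFrom (lookup ls i))) (allFin n)
          ≡⟨ cong concat (map-allFin (λ l → map codeEdge′ (edgesFrom l))) ⟩
        concatMap (λ l → map codeEdge′ (edgesFrom l)) ls
          ≡⟨ sym (map-concatMap codeEdge′ edgesFrom ls) ⟩
        map codeEdge′ (edgesOf ls) ∎))
        where
        open ≡-Reasoning
        codeEdge : Subset n × Fin n → 𝔻
        codeEdge = codeProduct (λ T → codeList codeBool (Vec.toList T)) (λ d → codeℕ (toℕ d))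
        codeEdge′ : List Bool × ℕ → 𝔻
        codeEdge′ = codeProduct (codeList codeBool) codeℕ
        edgeFrom : Line → List ELDAxiom → List Bool × ℕ
        edgeFrom l ps = map (λ η → does (η ∈? ps)) (labels ls) , indexOf (proj₁ l) (labels ls)
        edgesFrom : Line → List (List Bool × ℕ)
        edgesFrom l = map (edgeFrom l) (proj₂ l)
        toList-tabulate : ∀ {m} (f : Fin m → Bool) → Vec.toList (Vec.tabulate f) ≡ tabulate f
        toList-tabulate {zero}  f = refl
        toList-tabulate {suc m} f = cong (f zero ∷_) (toList-tabulate (λ i → f (suc i)))
        sameCode : ∀ i ps → codeEdge (premiseSet ps , i) ≡ codeEdge′ (edgeFrom (lookup ls i) ps)
        sameCode i ps = cong₂ _∙_
          (cong (codeList codeBool) (begin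
            Vec.toList (premiseSet ps) ≡⟨ toList-tabulate (λ i → does (labelOf i ∈? ps)) ⟩
            tabulate (λ i → does (labelOf i ∈? ps)) ≡⟨ sym (map-tabulate (λ i → i) (λ i → does (labelOf i ∈? ps))) ⟩
            map (λ i → does (labelOf i ∈? ps)) (allFin n) ≡⟨ map-allFin (λ l → does (proj₁ l ∈? ps)) ⟩
            map (λ l → does (proj₁ l ∈? ps)) ls ≡⟨ map-∘ ls ⟩
            map (λ η → does (η ∈? ps)) (labels ls) ∎))
          (cong codeℕ (sym (indexOf-labelOf ord i)))
        codeList-map : ∀ {B C : Set} {b : B → 𝔻} {c : C → 𝔻} {us vs} → map b us ≡ map c vs → codeList b us ≡ codeList c vs
        codeList-map {us = []}    {[]}    _ = refl
        codeList-map {us = _ ∷ _} {_ ∷ _} e = cong₂ _∙_ (∷-injectiveˡ e) (codeList-map (∷-injectiveʳ e))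

    -- Completeness

    -- The invariant of the completion algorithm on which completeness rests. Conclusions other than
    -- `⊥ᵖ` occur in the ontology, so they are among the candidates of the saturation.
    ValidFor : ELDOntology → Implication → Set
    ValidFor O (αs , β) = (⊨ map atom αs ⇒ β ∷ []) × (∀ {α} → β ≡ atom α → α ∈ 𝒞 O)

    result-valid : ∀ {O I} → Result O I → ∀ {ι} → ι ∈ I → ValidFor O ι
    result-valid {O} r = iterations r λ ()
      where
      AllValid : List Implication → Set
      AllValid I = ∀ {ι} → ι ∈ I → ValidFor O ι
      visited : ∀ {I C J} → Visit O I C J → AllValid I → AllValid J
      visited (inconsistent _ _ v) I-valid (here refl) = v , λ ()
      visited (inconsistent _ _ v) I-valid (there ι∈)  = I-valid ι∈
      visited (consistent {αs} {βs} _ _ _ enum) I-valid ι∈ with ∈-++⁻ (map (λ β → αs , atom β) βs) ι∈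
      ... | inj₂ p = I-valid p
      ... | inj₁ p with ∈-map⁻ _ p
      ...   | β , β∈ , refl with Equivalence.to (enum β) β∈
      ...     | β∈𝒞 , v = v , λ { refl → β∈𝒞 }
      forEach : ∀ {Cs I J} → ForEach O Cs I J → AllValid I → AllValid J
      forEach done       I-valid = I-valid
      forEach (next v f) I-valid = forEach f (visited v I-valid)
      iterations : ∀ {𝒩 I J} → While O 𝒩 I J → AllValid I → AllValid J
      iterations (exit _)            I-valid = I-valid
      iterations (iterate _ _ _ _ f w) I-valid = iterations w (forEach f I-valid)

    axiomConcepts : ELDOntology → List ELD
    axiomConcepts O = concatMap (λ η → lhs η ∷ rhs η ∷ []) O

    -- `⊤` and `⊥` are put in by hand, because `R⊤`, `R⊥` and inconsistent constraints conclude them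
    -- even where they do not occur.
    initialConcepts : ELDOntology → ELD → ELD → List ELD
    initialConcepts O C D = ⊤ ∷ ⊥ ∷ C ∷ D ∷ axiomConcepts O

    axiomsOver : List ELD → List ELDAxiom
    axiomsOver Cs = concatMap (λ C → map (C ⊑_) Cs) Cs

    axiomsOver-∈ : ∀ {Cs C D} → C ∈ Cs → D ∈ Cs → (C ⊑ D) ∈ axiomsOver Cs
    axiomsOver-∈ {Cs} {C} C∈ D∈ = concatMap-∈⁺ Cs C∈ (∈-map⁺ (C ⊑_) D∈)

    -- The elements of the canonical model are the concepts in Sub, and the
    -- concept ⊥ is treated like a concept name, so that it may be inhabited.
    -- Elk's rules never use that ⊥ is empty, except for its propagation along
    -- roles, which holds in this model as well.
    module Canonical
      (O : ELDOntology) (Sub : List ELD) (Z : List ELDAxiom)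
      (⊤∈Sub : ⊤ ∈ Sub) (⊥∈Sub : ⊥ ∈ Sub)
      (O⊆Sub : axiomConcepts O ⊆ Sub)
      (children⊆Sub : ∀ {C D} → C ∈ Sub → D ∈ children C → D ∈ Sub)
      (closed : Closed O (axiomsOver Sub) Z)
      where

      derive : ∀ {C D ps} → C ∈ Sub → D ∈ Sub → ps ∈ steps O Z (C ⊑ D) → (C ⊑ D) ∈ Z
      derive C∈ D∈ ps∈ = closed (axiomsOver-∈ C∈ D∈) (step-source O Z _ ps∈)

      axiom-∈ : ∀ {η} → η ∈ O → lhs η ∈ Sub × rhs η ∈ Sub × η ∈ Z
      axiom-∈ {η} η∈O = l∈ , r∈ , closed (axiomsOver-∈ l∈ r∈) (∈-++⁺ˡ (∈-when⁺ (η ∈? O) η∈O (here refl)))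
        where
        l∈ = O⊆Sub (concatMap-∈⁺ O η∈O (here refl))
        r∈ = O⊆Sub (concatMap-∈⁺ O η∈O (there (here refl)))

      premiseSteps-⊆ : ∀ η → premiseSteps O Z η ⊆ steps O Z η
      premiseSteps-⊆ (C ⊑ D) ps∈ =
        ∈-++⁺ʳ (when (does (D ≟ᶜ C)) _) (∈-++⁺ʳ (when (does (D ≟ᶜ ⊤)) _) (∈-++⁺ʳ (concatMap _ (asConstraint D)) ps∈))

      reflexive : ∀ {C} → C ∈ Sub → (C ⊑ C) ∈ Z
      reflexive {C} C∈ = derive C∈ C∈ (∈-++⁺ˡ (∈-when⁺ (C ≟ᶜ C) refl (here refl)))

      top : ∀ {C} → C ∈ Sub → (C ⊑ ⊤) ∈ Z
      top {C} C∈ = derive C∈ ⊤∈Sub (∈-++⁺ʳ (when (does (⊤ ≟ᶜ C)) _) (∈-++⁺ˡ (∈-when⁺ (⊤ ≟ᶜ ⊤) refl (here refl))))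

      unary : ∀ {C D θ} → C ∈ Sub → D ∈ Sub → θ ∈ Z → (C ⊑ D) ∈ conclusions₁ θ → (C ⊑ D) ∈ Z
      unary {C} {D} {θ} C∈ D∈ θ∈ p = derive C∈ D∈ (premiseSteps-⊆ (C ⊑ D)
        (concatMap-∈⁺ Z θ∈ (∈-++⁺ˡ (∈-when⁺ ((C ⊑ D) ∈? conclusions₁ θ) p (here refl)))))

      binary : ∀ {C D θ₁ θ₂} → C ∈ Sub → D ∈ Sub → θ₁ ∈ Z → θ₂ ∈ Z → (C ⊑ D) ∈ conclusions₂ O θ₁ θ₂ → (C ⊑ D) ∈ Z
      binary {C} {D} {θ₁} {θ₂} C∈ D∈ θ₁∈ θ₂∈ p = derive C∈ D∈ (premiseSteps-⊆ (C ⊑ D)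
        (concatMap-∈⁺ Z θ₁∈ (∈-++⁺ʳ (when (does ((C ⊑ D) ∈? conclusions₁ θ₁)) _)
          (concatMap-∈⁺ Z θ₂∈ (∈-when⁺ ((C ⊑ D) ∈? conclusions₂ O θ₁ θ₂) p (here refl))))))

      trans-axiom : ∀ {C D E} → C ∈ Sub → (C ⊑ D) ∈ Z → (D ⊑ E) ∈ O → (C ⊑ E) ∈ Z
      trans-axiom {C} {D} {E} C∈ CD∈ DE∈ = let _ , E∈ , DE∈Z = axiom-∈ DE∈ in
        binary C∈ E∈ CD∈ DE∈Z (∈-++⁺ˡ (∈-when⁺ ((D ≟ᶜ D) ×-dec ((D ⊑ E) ∈? O)) (refl , DE∈) (here refl)))

      conjunction : ∀ {C D E} → C ∈ Sub → (D ⊓ E) ∈ Sub → (C ⊑ D) ∈ Z → (C ⊑ E) ∈ Z → (C ⊑ D ⊓ E) ∈ Z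
      conjunction {C} {D} {E} C∈ DE∈ p q = binary C∈ DE∈ p q
        (∈-++⁺ʳ (when (does ((D ≟ᶜ C) ×-dec ((C ⊑ E) ∈? O))) _) (∈-++⁺ˡ (∈-when⁺ (C ≟ᶜ C) refl (here refl))))

      module _ {C D E r} (C∈ : C ∈ Sub) (p : (C ⊑ some r D) ∈ Z) (q : (D ⊑ E) ∈ Z) where

        private
          successorConclusions : ∀ {η} → η ∈ (C ⊑ some r E) ∷ when (does (E ≟ᶜ ⊥)) ((C ⊑ ⊥) ∷ []) →
                                 η ∈ conclusions₂ O (C ⊑ some r D) (D ⊑ E)
          successorConclusions η∈ =
            ∈-++⁺ʳ (when (does ((some r D ≟ᶜ D) ×-dec ((D ⊑ E) ∈? O))) _)
              (∈-++⁺ʳ (when (does (C ≟ᶜ D)) _) (∈-++⁺ˡ (∈-when⁺ (D ≟ᶜ D) refl η∈)))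

        existential : some r E ∈ Sub → (C ⊑ some r E) ∈ Z
        existential E∈ = binary C∈ E∈ p q (successorConclusions (here refl))

        bottom : E ≡ ⊥ → (C ⊑ ⊥) ∈ Z
        bottom E≡⊥ = binary C∈ ⊥∈Sub p q (successorConclusions (there (∈-when⁺ (E ≟ᶜ ⊥) E≡⊥ (here refl))))

      constraint : ∀ {C γs δ} → C ∈ Sub → concept δ ∈ Sub → (⊨ γs ⇒ δ ∷ []) →
                   (∀ {γ} → γ ∈ γs → (C ⊑ concept γ) ∈ Z) → (C ⊑ concept δ) ∈ Z
      constraint {C} {γs} {δ} C∈ δ∈ valid known = derive C∈ δ∈
        (∈-++⁺ʳ (when (does (concept δ ≟ᶜ C)) _) (∈-++⁺ʳ (when (does (concept δ ≟ᶜ ⊤)) _) (∈-++⁺ˡ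
          (concatMap-∈⁺ (asConstraint (concept δ)) (asConstraint-complete δ)
            (∈-when⁺ (valid? (knownConstraints Z C , δ ∷ [])) stronger (here refl))))))
        where
        stronger : ⊨ knownConstraints Z C ⇒ δ ∷ []
        stronger x sat = valid x (All.tabulate λ {γ} γ∈ → All.lookup sat (knownConstraints-complete Z C γ (known γ∈)))

      infix 4 _⊩ᶜ_

      -- Defined on all concepts, since those inside the Elk-proof need not abstract anything in
      -- `Sub`. A fresh name is read as the constraint that it stands for.
      _⊩ᶜ_ : ELD → EL → Set
      F ⊩ᶜ ⊤               = Unit
      F ⊩ᶜ ⊥               = (F ⊑ ⊥) ∈ Z
      F ⊩ᶜ name (inj₁ A)   = (F ⊑ name A) ∈ Z
      F ⊩ᶜ name (inj₂ α)   = (F ⊑ [ α ]) ∈ Z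
      F ⊩ᶜ C ⊓ D           = F ⊩ᶜ C × F ⊩ᶜ D
      F ⊩ᶜ some r C        = ∃[ G ] G ∈ Sub × (F ⊑ some r G) ∈ Z × G ⊩ᶜ C

      -- The successor that witnesses an existential restriction may be any `G` in `Sub`; by
      -- induction `G ⊑ D` has been found, and `R∃` replaces `G` by `D`.
      ⊩ᶜ-complete : ∀ D {F} → F ∈ Sub → D ∈ Sub → F ⊩ᶜ D ⁻ → (F ⊑ D) ∈ Z
      ⊩ᶜ-complete ⊤          F∈ D∈ _ = top F∈
      ⊩ᶜ-complete ⊥          F∈ D∈ p = p
      ⊩ᶜ-complete (name A)   F∈ D∈ p = p
      ⊩ᶜ-complete [ α ]      F∈ D∈ p = p
      ⊩ᶜ-complete (C ⊓ D)    F∈ D∈ (p , q) = conjunction F∈ D∈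
        (⊩ᶜ-complete C F∈ (children⊆Sub D∈ (here refl)) p) (⊩ᶜ-complete D F∈ (children⊆Sub D∈ (there (here refl))) q)
      ⊩ᶜ-complete (some r D) F∈ D∈ (G , G∈ , p , q) =
        existential F∈ p (⊩ᶜ-complete D G∈ (children⊆Sub D∈ (here refl)) q) D∈

      -- An existential restriction is witnessed by its own filler, which forces its abstraction
      -- because `R₀` puts `D ⊑ D` into `Z`.
      ⊩ᶜ-sound : ∀ D {F} → F ∈ Sub → D ∈ Sub → (F ⊑ D) ∈ Z → F ⊩ᶜ D ⁻
      ⊩ᶜ-sound ⊤          F∈ D∈ p = _
      ⊩ᶜ-sound ⊥          F∈ D∈ p = p
      ⊩ᶜ-sound (name A)   F∈ D∈ p = p
      ⊩ᶜ-sound [ α ]      F∈ D∈ p = p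
      ⊩ᶜ-sound (C ⊓ D)    F∈ D∈ p =
        ⊩ᶜ-sound C F∈ C∈ (unary F∈ C∈ p (here refl)) , ⊩ᶜ-sound D F∈ D∈′ (unary F∈ D∈′ p (there (here refl)))
        where
        C∈  = children⊆Sub D∈ (here refl)
        D∈′ = children⊆Sub D∈ (there (here refl))
      ⊩ᶜ-sound (some r D) F∈ D∈ p = D , D∈′ , p , ⊩ᶜ-sound D D∈′ D∈′ (reflexive D∈′)
        where D∈′ = children⊆Sub D∈ (here refl)

      Holds : ELAxiom → Set
      Holds (C ⊑ D) = ∀ {F} → F ∈ Sub → F ⊩ᶜ C → F ⊩ᶜ D

      ⨅-elim : ∀ {F D} Ds → D ∈ Ds → F ⊩ᶜ ⨅ Ds → F ⊩ᶜ D
      ⨅-elim (_ ∷ [])     (here refl) p       = p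
      ⨅-elim (_ ∷ _ ∷ _)  (here refl) (p , _) = p
      ⨅-elim (_ ∷ E ∷ Es) (there D∈)  (_ , p) = ⨅-elim (E ∷ Es) D∈ p

      rule-holds : ∀ {O′ ηs η} → ElkRule O′ ηs η → All Holds ηs → Holds η
      rule-holds R₀       _             F∈ p = p
      rule-holds R⊤       _             F∈ p = _
      rule-holds (R⊑ _)   (h ∷ k ∷ [])  F∈ p = k F∈ (h F∈ p)
      rule-holds (R⊓⁻ {Ds = Ds} D∈) (h ∷ []) F∈ p = ⨅-elim Ds D∈ (h F∈ p)
      rule-holds R⊓⁺      (h ∷ k ∷ [])  F∈ p = h F∈ p , k F∈ p
      rule-holds R∃       (h ∷ k ∷ [])  F∈ p = let G , G∈ , q , s = h F∈ p in G , G∈ , q , k G∈ s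
      rule-holds R⊥       (h ∷ k ∷ [])  F∈ p = let G , G∈ , q , s = h F∈ p in bottom F∈ q (k G∈ s) refl

      constraint-∈Sub : ∀ C {α} → C ∈ Sub → α ∈ constraints C → [ α ] ∈ Sub
      constraint-∈Sub [ α ]      C∈ (here refl) = C∈
      constraint-∈Sub (C ⊓ D)    C∈ α∈ with ∈-++⁻ (constraints C) α∈
      ... | inj₁ p = constraint-∈Sub C (children⊆Sub C∈ (here refl)) p
      ... | inj₂ p = constraint-∈Sub D (children⊆Sub C∈ (there (here refl))) p
      constraint-∈Sub (some r C) C∈ α∈ = constraint-∈Sub C (children⊆Sub C∈ (here refl)) α∈

      𝒞-∈Sub : ∀ {α} → α ∈ 𝒞 O → [ α ] ∈ Sub
      𝒞-∈Sub α∈ with concatMap-∈⁻ O α∈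
      ... | η , η∈ , p with ∈-++⁻ (constraints (lhs η)) p
      ...   | inj₁ q = constraint-∈Sub (lhs η) (proj₁ (axiom-∈ η∈)) q
      ...   | inj₂ q = constraint-∈Sub (rhs η) (proj₁ (proj₂ (axiom-∈ η∈))) q

      abstraction-⊩ᶜ : ∀ β {F} → (F ⊑ concept β) ∈ Z → F ⊩ᶜ abstraction β
      abstraction-⊩ᶜ ⊥ᵖ       p = p
      abstraction-⊩ᶜ (atom α) p = p

      -- Forcing the conjunction of fresh names means that `F ⊑ [ α ]` has been found for each `α`,
      -- which are the premises of a concrete domain inference with context `F`.
      implication-holds : ∀ ι → ValidFor O ι → Holds (implicationAxiom ι)
      implication-holds (αs , β) (valid , β∈𝒞) {F} F∈ p = abstraction-⊩ᶜ β (constraint F∈ (β∈Sub β β∈𝒞) valid known)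
        where
        β∈Sub : ∀ β → (∀ {α} → β ≡ atom α → α ∈ 𝒞 O) → concept β ∈ Sub
        β∈Sub ⊥ᵖ       _   = ⊥∈Sub
        β∈Sub (atom α) α∈𝒞 = 𝒞-∈Sub (α∈𝒞 refl)
        known : ∀ {γ} → γ ∈ map atom αs → (F ⊑ concept γ) ∈ Z
        known γ∈ with ∈-map⁻ atom γ∈
        ... | α , α∈ , refl = ⨅-elim (map (λ α → abstraction (atom α)) αs) (∈-map⁺ _ α∈) p

      -- For an axiom of the ontology, forcing is turned into membership in `Z`, where `R⊑` applies,
      -- and back again.
      completed-holds : ∀ {I} → (∀ {ι} → ι ∈ I → ValidFor O ι) → ∀ {η} → η ∈ completed O I → Holds η
      completed-holds valid η∈ with ∈-++⁻ (O ⁻ᴼ) η∈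
      ... | inj₁ p with ∈-map⁻ _ p
      ...   | (C ⊑ D) , CD∈ , refl = λ F∈ q → let C∈ , D∈ , _ = axiom-∈ CD∈ in
              ⊩ᶜ-sound D F∈ D∈ (trans-axiom F∈ (⊩ᶜ-complete C F∈ C∈ q) CD∈)
      completed-holds valid η∈ | inj₂ p with ∈-map⁻ implicationAxiom p
      ... | ι , ι∈ , refl = implication-holds ι (valid ι∈)

      -- Induction along the premises: on the finite set of vertices, acyclicity makes the premise
      -- relation well-founded.
      proof-holds : ∀ {O′ η G} → (∀ {θ} → θ ∈ O′ → Holds θ) → IsElkProof O′ η G → Holds η
      proof-holds {O′} {η} {G} axioms P = subst Holds sink-label (vertex-holds sink (premise-wellFounded sink))
        where
        open Hypergraph G
        open IsProof P
        premise-wellFounded : WellFounded (TransClosure Premise)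
        premise-wellFounded = spo-wellFounded record
          { isEquivalence = isEquivalence
          ; irrefl        = λ { refl → acyclic _ }
          ; trans         = transitive Premise
          ; <-resp-≈      = (λ { refl p → p }) , λ { refl p → p }
          }
        vertex-holds : ∀ v → Acc (TransClosure Premise) v → Holds (label v)
        vertex-holds v (acc rs) with any? (λ (T , d) → d ≟ᶠ v) edges
        ... | no ¬edge = axioms (leaves v λ T d e∈ d≡v → ¬edge (lose e∈ d≡v))
        ... | yes edge with find edge
        ...   | (T , .v) , e∈ , refl with inferences T v e∈
        ...     | vs , enum , rule = rule-holds rule (AllP.map⁺ (All.tabulate λ {u} u∈ →
                    vertex-holds u (rs [ T , e∈ , Equivalence.from (enum u) u∈ ])))

    -- The program and the proof that it outputs

    -- The last component holds the code of the given proofs as a bare tree, so that `inputCode`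
    -- agrees with `codeInput` by computation.
    Input : Set
    Input = ELDOntology × ELD × ELD × 𝔻

    candidates : ELDOntology → ELD → ELD → List ELDAxiom
    candidates O C D = axiomsOver (subconcepts (initialConcepts O C D))

    -- The rounds are more numerous than the candidates, so one of them adds nothing.
    derivable : ELDOntology → ELD → ELD → List ELDAxiom
    derivable O C D = saturate O (candidates O C D) ((C ⊑ D) ∷ candidates O C D)

    proofLines : ELDOntology → ELD → ELD → List Line
    proofLines O C D = prune (C ⊑ D) (lines O (derivable O C D))

    inputCode : Input → 𝔻
    inputCode = codeProduct codeAxioms (codeProduct codeELD (codeProduct codeELD 𝔻-id))

    private
      Oᴾ : PolyTime inputCode codeAxioms proj₁
      Oᴾ = π₁
      Cᴾ : PolyTime inputCode codeELD (λ x → proj₁ (proj₂ x))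
      Cᴾ = π₂ ⟫ π₁
      Dᴾ : PolyTime inputCode codeELD (λ x → proj₁ (proj₂ (proj₂ x)))
      Dᴾ = π₂ ⟫ π₂ ⟫ π₁

    candidatesᴾ : PolyTime inputCode codeAxioms (λ (O , C , D , _) → candidates O C D)
    candidatesᴾ = subconceptsᴾ ([ constᴾ ⊤ ]ᴾ ++ᴾ ([ constᴾ ⊥ ]ᴾ ++ᴾ ([ Cᴾ ]ᴾ ++ᴾ ([ Dᴾ ]ᴾ ++ᴾ
        concatMapᴾ Oᴾ ([ lhsᴾ π₂ ]ᴾ ++ᴾ [ rhsᴾ π₂ ]ᴾ)))))
      ⟫ concatMapᴾ idᴾ (mapᴾ π₁ ((π₁ ⟫ π₂) ⊑ᴾ π₂))

    proofLinesᴾ : PolyTime inputCode (codeList codeLine) (λ (O , C , D , _) → proofLines O C D)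
    proofLinesᴾ = pruneᴾ (Cᴾ ⊑ᴾ Dᴾ) (linesᴾ Oᴾ (saturateᴾ Oᴾ candidatesᴾ ([ Cᴾ ⊑ᴾ Dᴾ ]ᴾ ++ᴾ candidatesᴾ)))

    outputᴾ : PolyTime inputCode (codeProduct codeAxioms codeEdges)
                       (λ (O , C , D , _) → labels (proofLines O C D) , edgesOf (proofLines O C D))
    outputᴾ = proofLinesᴾ ⟫ (mapᴾ idᴾ (π₂ ⟫ π₁) ,ᴾ edgesOfᴾ idᴾ)

    module _ (O : ELDOntology) (C D : ELD) (C⊑D∈ : (C ⊑ D) ∈ derivable O C D) where

      private
        Z-lines : labels (lines O (derivable O C D)) ≡ derivable O C D × Ordered O (lines O (derivable O C D))
        Z-lines = lines-ordered O (saturate-derived O (candidates O C D) ((C ⊑ D) ∷ candidates O C D))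

        kept : List Line
        kept = needed ((C ⊑ D) ∷ []) (lines O (derivable O C D))

        kept-head : ∃[ s ] ∃[ ls ] kept ≡ ((C ⊑ D) , s) ∷ ls
        kept-head = needed-head (C ⊑ D) _ (lines O (derivable O C D)) (here refl) (λ { (here e) → e ; (there ()) })
          (subst ((C ⊑ D) ∈_) (sym (proj₁ Z-lines)) C⊑D∈)

      open Graph O kept (needed-ordered O _ (proj₂ Z-lines)) using (graph; isProof; codeGraph)

      extractedProof : Hypergraph ELDAxiom
      extractedProof = graph

      extractedProof-isProof : IsELDProof O (C ⊑ D) extractedProof
      extractedProof-isProof = isProof (proj₂ (proj₂ kept-head)) (needed-used _ (lines O (derivable O C D)))

      extractedProof-code : codeOutput extractedProof ≡
        codeProduct codeAxioms codeEdges (labels (proofLines O C D) , edgesOf (proofLines O C D))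
      extractedProof-code = trans codeGraph
        (cong (λ ls → codeProduct codeAxioms codeEdges (labels ls , edgesOf ls)) (sym (prune-needed (C ⊑ D) (lines O (derivable O C D)))))

    -- The element `C` forces `C ⁻` by reflexivity, hence `D ⁻` by the Elk-proof, and `D` being a
    -- candidate, `C ⊑ D` has been found.
    derivable-complete : ∀ O I → Result O I → ∀ C D (P′ : Hypergraph ELAxiom) →
                         IsElkProof (completed O I) (C ⁻ ⊑ D ⁻) P′ → (C ⊑ D) ∈ derivable O C D
    derivable-complete O I result C D P′ isElkProof =
      ⊩ᶜ-complete D C∈ D∈ (proof-holds (completed-holds (result-valid result)) isElkProof C∈ (⊩ᶜ-sound C C∈ C∈ (reflexive C∈)))
      where
      Cs = initialConcepts O C D
      C∈ = ⊆-subconcepts Cs (there (there (here refl)))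
      D∈ = ⊆-subconcepts Cs (there (there (there (here refl))))
      open Canonical O (subconcepts Cs) (derivable O C D)
        (⊆-subconcepts Cs (here refl)) (⊆-subconcepts Cs (there (here refl)))
        (λ E∈ → ⊆-subconcepts Cs (there (there (there (there E∈)))))
        (children-subconcepts Cs)
        (saturate-closed O (candidates O C D) (C ⊑ D))

lemma1 : (S : Signature) (𝒟 : ConcreteDomain) → let open Logic S 𝒟 in
    PAdmissible →
    Σ[ p ∈ Prog ] Σ[ f ∈ Poly ]
    ((O : ELDOntology) (I : List Implication) → Result O I →
    (C D : ELD) → constraints C ⊆ 𝒞 O → constraints D ⊆ 𝒞 O →
    (P′ : Hypergraph ELAxiom) → IsElkProof (completed O I) (C ⁻ ⊑ D ⁻) P′ →
    (Qs : List (Implication × Hypergraph Constraint)) →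
    All (λ (ι , Q) → IsDProof ι Q) Qs →
    (∀ ι → ι ∈ I → UsedIn P′ ι → ι ∈ map proj₁ Qs) →
    Σ[ P ∈ Hypergraph ELDAxiom ]
    IsELDProof O (C ⊑ D) P ×
    (p ⊢ codeInput O C D P′ Qs ⇓ codeOutput P within f))
lemma1 S 𝒟 padm = program outputᴾ , time outputᴾ , λ O I result C D _ _ P′ isElkProof Qs _ _ →
  let C⊑D∈  = derivable-complete O I result C D P′ isElkProof
      input = O , C , D , codeHypergraph codeELAxiom P′ ∙
                          codeList (codeProduct codeImplication (codeHypergraph codeConstraint)) Qs
  in extractedProof O C D C⊑D∈ , extractedProof-isProof O C D C⊑D∈ ,
     subst (λ y → program outputᴾ ⊢ codeInput O C D P′ Qs ⇓ y within time outputᴾ)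
       (sym (extractedProof-code O C D C⊑D∈)) (runs outputᴾ input)
  where
  open Logic S 𝒟
  open Construction S 𝒟
  open WithOracle padm
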